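{- Let $S$ be a recurrent specular set on the finite alphabet $A$ relative to the involution $\theta$. For any nonempty $w\in S$, the set $\mathcal{R}_S(w)$ of right return words to $w$ in $S$ is a basis of the even subgroup of $G_\theta$ (that is, the even subgroup is a free group and $\mathcal{R}_S(w)$ is a basis of this free group).
   Context: Words are over a finite alphabet $A$; $\varepsilon$ is the empty word. A set $S$ of words on $A$ is factorial if it contains $A$ and all the factors of its elements. For $w\in S$ let $L(w)=\{a\in A\mid aw\in S\}$, $R(w)=\{a\in A\mid wa\in S\}$, $B(w)=\{(a,b)\in A\times A\mid awb\in S\}$. A factorial set $S$ is biextendable if $B(w)\neq\emptyset$ for all $w\in S$. The extension graph $\mathcal{E}(w)$ is the undirected graph whose vertex set is the disjoint union of $L(w)$ and $R(w)$ and whose edges are the pairs in $B(w)$. A biextendable set $S$ is a tree set of characteristic $c$ if $\mathcal{E}(w)$ is a tree for every nonempty $w\in S$ and $\mathcal{E}(\varepsilon)$ is a disjoint union of $c$ trees. Let $\theta$ be an involution on $A$ (possibly with fixed points) and let $G_\theta$ be the group generated by $A$ with relations $a\theta(a)=1$, $a\in A$ (so $a^{ -1}=\theta(a)$). A word is reduced if it has no factor $a\theta(a)$ with $a\in A$; every element of $G_\theta$ is represented by a unique reduced word, and reduced words are identified with elements of $G_\theta$. A laminary set on $A$ relative to $\theta$ is a biextendable set of reduced words closed under taking inverses. A specular set is a laminary set which is a tree set of characteristic $2$. A set $S\ne\{\varepsilon\}$ is recurrent if it is factorial and for all $u,w\in S$ there is $v\in S$ with $uvw\in S$. In a specular set $S$,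 each letter $a\in A$ occurs exactly twice as a vertex of $\mathcal{E}(\varepsilon)$, once in $L(\varepsilon)$ and once in $R(\varepsilon)$. The letter $a$ is even if its two occurrences lie in the same tree of $\mathcal{E}(\varepsilon)$, and odd otherwise. A word is even if it has an even number of (occurrences of) odd letters, and odd otherwise. The even subgroup is the subgroup of $G_\theta$ formed by the elements represented by even words. A complete return word to $w$ is a word of $S$ having $w$ as a proper prefix and as a proper suffix, and such that $w$ is not an internal factor of it ($v$ is an internal factor of $y$ if $y=uvu'$ with $u,u'$ nonempty). A right return word to $w$ in $S$ is a word $y$ such that $wy$ is a complete return word to $w$. -}

module Defs where

open import Algebra.Bundles using (Group)
open import Algebra.Definitions using (Involutive; Congruent₁)
open import Algebra.Morphism.Structures using (module GroupMorphisms)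
open import Data.Fin using (Fin; _≟_)
open import Data.List using (List; []; _∷_; [_]; _++_; _∷ʳ_; map; reverse; length; filter)
open import Data.List.Properties using (++-assoc; ++-identityʳ; unfold-reverse)
open import Data.List.Relation.Unary.Linked using (Linked)
open import Data.List.Relation.Unary.Unique.Propositional using (Unique)
open import Data.Nat using (ℕ; _≤_)
open import Data.Nat.Divisibility using (_∣_)
open import Data.Product using (Σ; _×_; _,_; proj₁; proj₂; ∃; ∃-syntax; ∃₂)
open import Data.Sum using (_⊎_; inj₁; inj₂; swap)
import Data.Sum.Relation.Binary.Pointwise as ⊎
open import Function.Bundles using (_⇔_)
open import Level using (Level; _⊔_; 0ℓ)
open import Relation.Binary using (Rel; Setoid; Symmetric; Reflexive)
open import Relation.Binary.Construct.Closure.ReflexiveTransitive using (Star)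
import Relation.Binary.Construct.On as On
open import Relation.Binary.PropositionalEquality as ≡ using (_≡_; _≢_; refl; cong)
open import Relation.Nullary using (¬_; Dec; ¬?)
open import Relation.Unary using (Pred; _∈_; _≐_; ｛_｝)

private variable
  a ℓ : Level

-- The group with generators A and relations x · θ(x) = 1, as words over A
-- modulo the congruence generated by these relations.  For a setoid A, equal
-- letters are identified.

module InvolutiveGroup
  (A : Setoid a ℓ) (θ : Setoid.Carrier A → Setoid.Carrier A)
  (θ-cong : Congruent₁ (Setoid._≈_ A) θ) (θ-inv : Involutive (Setoid._≈_ A) θ)
  where

  private module A = Setoid A

  Word : Set a
  Word = List A.Carrier

  infix 4 _∼_

  data _∼_ : Rel Word (a ⊔ ℓ) where
    nil    : [] ∼ []
    cons   : ∀ {x y u v} → x A.≈ y → u ∼ v → x ∷ u ∼ y ∷ v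
    cancel : ∀ x u → x ∷ θ x ∷ u ∼ u
    sym    : ∀ {u v} → u ∼ v → v ∼ u
    trans  : ∀ {u v w} → u ∼ v → v ∼ w → u ∼ w

  inverse : Word → Word
  inverse u = reverse (map θ u)

  ∼-refl : Reflexive _∼_
  ∼-refl {[]}    = nil
  ∼-refl {x ∷ u} = cons A.refl ∼-refl

  ∼-reflexive : ∀ {u v} → u ≡ v → u ∼ v
  ∼-reflexive refl = ∼-refl

  ++-congˡ : ∀ u {v v′} → v ∼ v′ → u ++ v ∼ u ++ v′
  ++-congˡ []      p = p
  ++-congˡ (x ∷ u) p = cons A.refl (++-congˡ u p)

  ++-congʳ : ∀ {u u′} v → u ∼ u′ → u ++ v ∼ u′ ++ v
  ++-congʳ v nil          = ∼-refl
  ++-congʳ v (cons x p)   = cons x (++-congʳ v p)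
  ++-congʳ v (cancel x u) = cancel x (u ++ v)
  ++-congʳ v (sym p)      = sym (++-congʳ v p)
  ++-congʳ v (trans p q)  = trans (++-congʳ v p) (++-congʳ v q)

  ++-cong : ∀ {u u′ v v′} → u ∼ u′ → v ∼ v′ → u ++ v ∼ u′ ++ v′
  ++-cong {u′ = u′} {v = v} p q = trans (++-congʳ v p) (++-congˡ u′ q)

  inverse-∷ : ∀ x u → inverse (x ∷ u) ≡ inverse u ∷ʳ θ x
  inverse-∷ x u = unfold-reverse (θ x) (map θ u)

  inverse-cong : ∀ {u v} → u ∼ v → inverse u ∼ inverse v
  inverse-cong nil = nil
  inverse-cong (cons {x} {y} {u} {v} x≈y p) =
    trans (∼-reflexive (inverse-∷ x u))
      (trans (++-cong (inverse-cong p) (cons (θ-cong x≈y) nil))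
        (∼-reflexive (≡.sym (inverse-∷ y v))))
  inverse-cong (cancel x u) =
    trans (∼-reflexive (≡.trans (inverse-∷ x (θ x ∷ u))
                         (≡.trans (cong (_∷ʳ θ x) (inverse-∷ (θ x) u))
                           (++-assoc (inverse u) [ θ (θ x) ] [ θ x ]))))
      (trans (++-congˡ (inverse u) (trans (cons (θ-inv x) ∼-refl) (cancel x [])))
        (∼-reflexive (++-identityʳ (inverse u))))
  inverse-cong (sym p)     = sym (inverse-cong p)
  inverse-cong (trans p q) = trans (inverse-cong p) (inverse-cong q)

  inverseˡ : ∀ u → inverse u ++ u ∼ []
  inverseˡ []      = nil
  inverseˡ (x ∷ u) =
    trans (∼-reflexive (≡.trans (cong (_++ x ∷ u) (inverse-∷ x u))
                         (++-assoc (inverse u) [ θ x ] (x ∷ u))))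
      (trans (++-congˡ (inverse u)
               (trans (cons A.refl (cons (A.sym (θ-inv x)) ∼-refl)) (cancel (θ x) u)))
        (inverseˡ u))

  inverseʳ : ∀ u → u ++ inverse u ∼ []
  inverseʳ []      = nil
  inverseʳ (x ∷ u) =
    trans (∼-reflexive (cong (x ∷_) (≡.trans (cong (u ++_) (inverse-∷ x u))
                                      (≡.sym (++-assoc u (inverse u) [ θ x ])))))
      (trans (cons A.refl (++-congʳ [ θ x ] (inverseʳ u))) (cancel x []))

  group : Group a (a ⊔ ℓ)
  group = record
    { Carrier = Word
    ; _≈_     = _∼_
    ; _∙_     = _++_
    ; ε       = []
    ; _⁻¹     = inverse
    ; isGroup = record
      { isMonoid = record
        { isSemigroup = record
          { isMagma = record
            { isEquivalence = record { refl = ∼-refl ; sym = sym ; trans = trans }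
            ; ∙-cong        = ++-cong
            }
          ; assoc = λ u v w → ∼-reflexive (++-assoc u v w)
          }
        ; identity = (λ _ → ∼-refl) , (λ u → ∼-reflexive (++-identityʳ u))
        }
      ; inverse = inverseˡ , inverseʳ
      ; ⁻¹-cong = inverse-cong
      }
    }

-- The free group on X: each generator inj₁ x has the formal inverse inj₂ x.

module FreeGroup (X : Setoid a ℓ) where

  private
    swap-cong : Congruent₁ (⊎.Pointwise (Setoid._≈_ X) (Setoid._≈_ X)) swap
    swap-cong (⊎.inj₁ p) = ⊎.inj₂ p
    swap-cong (⊎.inj₂ p) = ⊎.inj₁ p

    swap-inv : Involutive (⊎.Pointwise (Setoid._≈_ X) (Setoid._≈_ X)) swap
    swap-inv (inj₁ _) = ⊎.inj₁ (Setoid.refl X)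
    swap-inv (inj₂ _) = ⊎.inj₂ (Setoid.refl X)

  open InvolutiveGroup (X ⊎.⊎ₛ X) swap swap-cong swap-inv public

module _ {c ℓ p : Level} (G : Group c ℓ) where

  open Group G using (Carrier; _≈_; _∙_; ε; _⁻¹; setoid)

  -- Equality of elements of X is equality in G: membership proofs, and the
  -- choice of representatives, play no role.
  subsetSetoid : Pred Carrier p → Setoid (c ⊔ p) ℓ
  subsetSetoid X = On.setoid {B = Σ Carrier X} setoid proj₁

  module _ (X : Pred Carrier p) where

    private module F = FreeGroup (subsetSetoid X)

    eval : F.Word → Carrier
    eval []                 = ε
    eval (inj₁ (x , _) ∷ u) = x ∙ eval u
    eval (inj₂ (x , _) ∷ u) = x ⁻¹ ∙ eval u

    open GroupMorphisms (Group.rawGroup F.group) (Group.rawGroup G)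
      using (IsGroupMonomorphism)

    -- H is a free subgroup of G with basis X: the homomorphism from the free
    -- group on X to G extending the inclusion of X is an isomorphism onto H.
    record IsBasisOf {q : Level} (H : Pred Carrier q) : Set (c ⊔ ℓ ⊔ p ⊔ q) where
      field
        isMonomorphism : IsGroupMonomorphism eval
        image          : ∀ g → g ∈ H ⇔ (∃[ u ] eval u ≈ g)

record Graph (V : Set) (ℓ : Level) : Set (Level.suc ℓ) where
  field
    Vertex : Pred V ℓ
    Adj    : Rel V ℓ
    symm   : Symmetric Adj

module _ {V : Set} where

  induced : Graph V ℓ → Pred V 0ℓ → Graph V ℓ
  induced Γ P = record
    { Vertex = λ x → Vertex x × P x
    ; Adj    = λ x y → Adj x y × P x × P y
    ; symm   = λ (e , p , q) → symm e , q , p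
    }
    where open Graph Γ

  -- The closed walk x , xs , x visiting each vertex of x ∷ xs once.
  IsCycle : Graph V ℓ → V → List V → Set ℓ
  IsCycle Γ x xs =
    2 ≤ length xs × Unique (x ∷ xs) × Linked (Graph.Adj Γ) (x ∷ xs ∷ʳ x)

  record IsTree (Γ : Graph V ℓ) : Set ℓ where
    open Graph Γ
    field
      nonempty  : ∃ Vertex
      connected : ∀ {x y} → Vertex x → Vertex y → Star Adj x y
      acyclic   : ∀ x xs → ¬ IsCycle Γ x xs

  -- treeOf x is the tree containing x; its values outside Vertex are irrelevant.
  record IsDisjointUnionOfTrees (k : ℕ) (Γ : Graph V ℓ) : Set ℓ where
    open Graph Γ
    field
      treeOf   : V → Fin k
      adj⇒same : ∀ {x y} → Adj x y → treeOf x ≡ treeOf y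
      isTree   : ∀ i → IsTree (induced Γ (λ x → treeOf x ≡ i))

module _ {n : ℕ} where

  private
    A : Set
    A = Fin n

    W : Set
    W = List A

  record IsFactorial (S : Pred W ℓ) : Set ℓ where
    field
      letters : ∀ a → [ a ] ∈ S
      factors : ∀ u v w → u ++ v ++ w ∈ S → v ∈ S

  module _ (S : Pred W ℓ) where

    L : W → Pred A ℓ
    L w a = a ∷ w ∈ S

    R : W → Pred A ℓ
    R w a = w ∷ʳ a ∈ S

    B : W → Pred (A × A) ℓ
    B w (a , b) = a ∷ w ∷ʳ b ∈ S

    data LRVertex (w : W) : Pred (A ⊎ A) ℓ where
      left  : ∀ {a} → a ∈ L w → LRVertex w (inj₁ a)
      right : ∀ {a} → a ∈ R w → LRVertex w (inj₂ a)

    data Edge (w : W) : Rel (A ⊎ A) ℓ where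
      edge  : ∀ {a b} → (a , b) ∈ B w → Edge w (inj₁ a) (inj₂ b)
      edge⁻ : ∀ {a b} → (a , b) ∈ B w → Edge w (inj₂ b) (inj₁ a)

    -- When S is factorial, the endpoints of edges are automatically vertices.
    extensionGraph : W → Graph (A ⊎ A) ℓ
    extensionGraph w = record
      { Vertex = LRVertex w
      ; Adj    = Edge w
      ; symm   = λ { (edge p) → edge⁻ p ; (edge⁻ p) → edge p }
      }

    record IsBiextendable : Set ℓ where
      field
        isFactorial : IsFactorial S
        extendable  : ∀ {w} → w ∈ S → ∃ (B w)

    record IsTreeSet (k : ℕ) : Set ℓ where
      field
        isBiextendable : IsBiextendable
        treeOfNonempty : ∀ {w} → w ≢ [] → w ∈ S → IsTree (extensionGraph w)
        treesOfEmpty   : IsDisjointUnionOfTrees k (extensionGraph [])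

    record IsRecurrent : Set ℓ where
      field
        nontrivial  : ¬ (S ≐ ｛ [] ｝)
        isFactorial : IsFactorial S
        recurrence  : ∀ {u w} → u ∈ S → w ∈ S → ∃[ v ] u ++ v ++ w ∈ S

    record IsCompleteReturn (w y : W) : Set ℓ where
      field
        member       : y ∈ S
        properPrefix : ∃[ u ] u ≢ [] × y ≡ w ++ u
        properSuffix : ∃[ u ] u ≢ [] × y ≡ u ++ w
        notInternal  : ¬ (∃₂ λ u u′ → u ≢ [] × u′ ≢ [] × y ≡ u ++ w ++ u′)

    RightReturn : W → Pred W ℓ
    RightReturn w y = IsCompleteReturn w (w ++ y)

  module _ (θ : A → A) (θ-inv : Involutive _≡_ θ) where

    open InvolutiveGroup (≡.setoid A) θ (cong θ) θ-inv using (inverse; group)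

    Gθ : Group 0ℓ 0ℓ
    Gθ = group

    IsReduced : Pred W 0ℓ
    IsReduced w = ¬ (∃₂ λ u v → ∃[ a ] w ≡ u ++ a ∷ θ a ∷ v)

    record IsLaminary (S : Pred W ℓ) : Set ℓ where
      field
        isBiextendable : IsBiextendable S
        reduced        : ∀ {w} → w ∈ S → IsReduced w
        inverse-closed : ∀ {w} → w ∈ S → inverse w ∈ S

    record IsSpecular (S : Pred W ℓ) : Set ℓ where
      field
        isLaminary : IsLaminary S
        isTreeSet  : IsTreeSet S 2

    module _ {S : Pred W ℓ} (spec : IsSpecular S) where

      open IsSpecular spec using (isTreeSet)
      open IsTreeSet isTreeSet using (treesOfEmpty)
      open IsDisjointUnionOfTrees treesOfEmpty using (treeOf)

      -- Independent of the decomposition in spec: the trees are the connected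
      -- components of the extension graph of [].
      EvenLetter : Pred A 0ℓ
      EvenLetter a = treeOf (inj₁ a) ≡ treeOf (inj₂ a)

      evenLetter? : ∀ a → Dec (EvenLetter a)
      evenLetter? a = treeOf (inj₁ a) ≟ treeOf (inj₂ a)

      EvenWord : Pred W 0ℓ
      EvenWord w = 2 ∣ length (filter (λ a → ¬? (evenLetter? a)) w)

      EvenSubgroup : Pred (Group.Carrier Gθ) 0ℓ
      EvenSubgroup g = ∃[ v ] EvenWord v × Group._≈_ Gθ v g

{-# OPTIONS --safe #-}

-- Label the transitions of S, from a history to its extension by one letter, by
-- elements of a group H.  Because the extension graphs are forests, a label
-- depending on the last k + 1 letters of the history is gauge equivalent to one
-- depending on the last k; at k = 0 it is a map from letters to H.  Starting
-- from the label which reads a finite set of return words to w, every map from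
-- these return words to H is thus induced by a map from the letters.
--
-- * H free on the return words gives freeness, once a map on letters is extended
--   to the even subgroup: the two trees of the extension graph of the empty word
--   are the states of an automaton, and θ exchanges them.
-- * H = ℤ/2 bounds the number of return words by a count of maps, and then
--   recurrence makes w occur in all long words of S.
--
-- For generation one descends in the same way from long words to the empty word:
-- modulo the return words, the word read from an occurrence of w to the end of y
-- depends on y only, first because w occurs in y, then because the extension
-- graphs are connected.

module Submission where

open import Defs
open import Algebra.Bundles using (Group; CommutativeRing)
open import Algebra.Definitions using (Involutive)
import Algebra.Properties.Group as GroupProperties
open import Data.Bool using (Bool; true; false; not; _xor_)
open import Data.Bool.Properties using (not-injective; not-involutive; not-¬; xor-∧-commutativeRing)
open import Data.Empty using (⊥; ⊥-elim)
open import Data.Fin using (Fin; zero; suc; finToFun; funToFin; combine; opposite)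
import Data.Fin as Fin
import Data.Fin.Properties as Fin
open import Data.List using
  (List; []; _∷_; [_]; _++_; _∷ʳ_; length; initLast; _∷ʳ′_; lookup; take; drop; foldl;
   filter; map)
open import Data.List.Membership.Propositional.Properties using (∈-lookup; ∈-++⁺ˡ; ∈-++⁺ʳ)
import Data.List.Membership.Propositional as List
open import Data.List.Properties using
  (length-++; length-take; take++drop≡id; ++-identityʳ; ++-identityʳ-unique;
   ++-identityˡ-unique; ++-assoc; ++-cancelˡ; ∷-injective; ∷-injectiveʳ; ∷-injectiveˡ;
   ∷ʳ-injectiveˡ; foldl-++)
import Data.List.Properties as List
open import Data.List.Relation.Binary.Subset.Propositional using (_⊆_)
open import Data.List.Relation.Unary.All using (All; []; _∷_)
import Data.List.Relation.Unary.All as All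
open import Data.List.Relation.Unary.All.Properties using (¬Any⇒All¬)
open import Data.List.Relation.Unary.AllPairs using (AllPairs; []; _∷_)
open import Data.List.Relation.Unary.Any using (here; there)
open import Data.List.Relation.Unary.Linked using (Linked; [-]; _∷_)
open import Data.List.Relation.Unary.Unique.Propositional using (Unique)
open import Data.Nat using (ℕ; zero; suc; z≤n; s≤s; _≤_; _<_; _≤?_; _≟_; _⊔_; _+_)
open import Data.Nat.Divisibility using (_∣_; divides; ∣m∣n⇒∣m+n; ∣-refl; _∣0)
open import Data.Nat.Properties using
  (≤-refl; ≤-trans; ≤-reflexive; ≤-total; ≤∧≢⇒<; ≤⇒≯; ≰⇒>; ≮⇒≥; <⇒≤; <-irrefl; n≤1+n;
   m≤n⇒m≤1+n; m≤n+m; m≤m+n; m≤m⊔n; m≤n⊔m; m≤n⇒m⊓n≡m; _<?_; +-comm; +-suc; +-identityʳ;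
   +-cancelˡ-≤; +-monoʳ-≤; ^-monoʳ-<; module ≤-Reasoning)
open import Data.Product using (Σ; Σ-syntax; _×_; _,_; proj₁; proj₂; ∃; ∃₂; ∃-syntax)
open import Data.Sum using (_⊎_; inj₁; inj₂; reduce)
open import Data.Sum.Properties using (≡-dec)
import Data.Sum.Relation.Binary.Pointwise as ⊎
open import Function using (_∘_; case_of_; Inverse; mk⇔)
open import Level using (Level)
open import Relation.Binary using (DecidableEquality)
open import Relation.Binary.Construct.Closure.ReflexiveTransitive using (Star; ε; _◅_; _◅◅_)
import Relation.Binary.Construct.Closure.ReflexiveTransitive as Star
open import Relation.Binary.Definitions using (tri<; tri≈; tri>)
open import Relation.Binary.PropositionalEquality as ≡ using
  (_≡_; _≢_; _≗_; refl; cong; cong₂; subst)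
import Relation.Binary.Reasoning.Setoid as SetoidReasoning
open import Relation.Nullary using (¬_; Dec; yes; no; does; _×-dec_; _⊎-dec_; ¬?)
open import Relation.Nullary.Decidable using (dec-true; dec-false)
open import Relation.Unary using (Pred; Decidable; _∈_)

-- Walks and their holonomy in acyclic graphs.

module Walks {V : Set} (_≟_ : DecidableEquality V) {ℓ : Level} (Γ : Graph V ℓ)
  (irreflexive : ∀ {x} → ¬ Graph.Adj Γ x x)
  (acyclic : ∀ x xs → ¬ IsCycle Γ x xs)
  {c ℓ′ : Level} (H : Group c ℓ′) (wt : V → V → Group.Carrier H)
  (wt-inverse : ∀ {x y} → Graph.Adj Γ x y →
     Group._≈_ H (Group._∙_ H (wt x y) (wt y x)) (Group.ε H))
  where

  open Graph Γ
  open Group H renaming (ε to 1#; refl to ≈-refl; sym to ≈-sym; trans to ≈-trans) hiding (setoid)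
  open SetoidReasoning (Group.setoid H) hiding (stop)

  holonomy : ∀ {x y} → Star Adj x y → Carrier
  holonomy ε                 = 1#
  holonomy (_◅_ {x} {y} _ p) = wt x y ∙ holonomy p

  holonomy-◅◅ : ∀ {x y z} (p : Star Adj x y) (q : Star Adj y z) →
    holonomy (p ◅◅ q) ≈ holonomy p ∙ holonomy q
  holonomy-◅◅ ε       q = ≈-sym (identityˡ _)
  holonomy-◅◅ (_ ◅ p) q = ≈-trans (∙-congˡ (holonomy-◅◅ p q)) (≈-sym (assoc _ _ _))

  -- The list omits the end of the path: it is the vertex list of the cycle
  -- obtained by closing the path.
  data SimplePath : V → V → List V → Set ℓ where
    stop : ∀ {y} → SimplePath y y []
    step : ∀ {x z y vs} → Adj x z → x ≢ y → ¬ (x List.∈ vs) → SimplePath z y vs →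
      SimplePath x y (x ∷ vs)

  pathHolonomy : ∀ {x y vs} → SimplePath x y vs → Carrier
  pathHolonomy stop                     = 1#
  pathHolonomy (step {x} {z} _ _ _ p) = wt x z ∙ pathHolonomy p

  simplePath-unique : ∀ {x y vs} → SimplePath x y vs → Unique vs
  simplePath-unique stop              = []
  simplePath-unique (step _ _ x∉vs p) = ¬Any⇒All¬ _ x∉vs ∷ simplePath-unique p

  simplePath-end∉ : ∀ {x y vs} → SimplePath x y vs → ¬ (y List.∈ vs)
  simplePath-end∉ (step _ x≢y _ _) (here y≡x)   = x≢y (≡.sym y≡x)
  simplePath-end∉ (step _ _ _ p)   (there y∈vs) = simplePath-end∉ p y∈vs

  simplePath-linked : ∀ {x z y vs} → Adj x z → SimplePath z y vs → Linked Adj (x ∷ vs ∷ʳ y)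
  simplePath-linked e stop            = e ∷ [-]
  simplePath-linked e (step e′ _ _ p) = e ∷ simplePath-linked e′ p


  -- The end `y` together with `x` and `z` makes three distinct vertices, as `IsCycle` requires; a
  -- single edge closes only by backtracking.
  no-closing : ∀ {x z y vs} → SimplePath x y (x ∷ z ∷ vs) → ¬ Adj y x
  no-closing p e = acyclic _ _
    ( s≤s (s≤s z≤n)
    , ¬Any⇒All¬ _ (simplePath-end∉ p) ∷ simplePath-unique p
    , simplePath-linked e p)

  splitAt : ∀ x {z y vs} (q : SimplePath z y vs) →
    (x ≢ y × ¬ (x List.∈ vs)) ⊎
    (∃₂ λ us ws → Σ[ q₁ ∈ SimplePath z x us ] Σ[ q₂ ∈ SimplePath x y ws ]
      us ⊆ vs × pathHolonomy q ≈ pathHolonomy q₁ ∙ pathHolonomy q₂)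
  splitAt x {z} q with x ≟ z
  ... | yes refl = inj₂ (_ , _ , stop , q , (λ ()) , ≈-sym (identityˡ _))
  splitAt x stop | no x≢z = inj₁ (x≢z , λ ())
  splitAt x (step e z≢y z∉vs q) | no x≢z with splitAt x q
  ... | inj₁ (x≢y , x∉vs) = inj₁ (x≢y , λ { (here x≡z) → x≢z x≡z ; (there x∈vs) → x∉vs x∈vs })
  ... | inj₂ (us , ws , q₁ , q₂ , us⊆vs , eq) = inj₂
        ( _ , _ , step e (x≢z ∘ ≡.sym) (z∉vs ∘ us⊆vs) q₁ , q₂
        , (λ { (here p) → here p ; (there p) → there (us⊆vs p) })
        , ≈-trans (∙-congˡ eq) (≈-sym (assoc _ _ _)))

  -- If `x` already lies on the simplified tail, acyclicity forces the part before it to be the edge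
  -- just taken, walked back; by `wt-inverse`, deleting this backtracking leaves the holonomy
  -- unchanged.
  simplify : ∀ {x y} (p : Star Adj x y) →
    ∃ λ vs → Σ[ q ∈ SimplePath x y vs ] pathHolonomy q ≈ holonomy p
  simplify ε = [] , stop , ≈-refl
  simplify (_◅_ {x} e p) with simplify p
  ... | vs , q , eq with splitAt x q
  ... | inj₁ (x≢y , x∉vs) = x ∷ vs , step e x≢y x∉vs q , ∙-congˡ eq
  ... | inj₂ (_ , _ , stop , _) = ⊥-elim (irreflexive e)
  ... | inj₂ (_ , ws , step {z} e′ _ _ stop , q₂ , _ , eq′) = ws , q₂ , (begin
        pathHolonomy q₂                                  ≈⟨ identityˡ _ ⟨
        1# ∙ pathHolonomy q₂                             ≈⟨ ∙-congʳ (wt-inverse e) ⟨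
        (wt x z ∙ wt z x) ∙ pathHolonomy q₂              ≈⟨ assoc _ _ _ ⟩
        wt x z ∙ (wt z x ∙ pathHolonomy q₂)              ≈⟨ ∙-congˡ (∙-congʳ (identityʳ _)) ⟨
        wt x z ∙ ((wt z x ∙ 1#) ∙ pathHolonomy q₂)       ≈⟨ ∙-congˡ eq′ ⟨
        wt x z ∙ pathHolonomy q                          ≈⟨ ∙-congˡ eq ⟩
        wt x z ∙ holonomy p                              ∎)
  ... | inj₂ (_ , _ , q₁@(step _ _ _ (step _ _ _ _)) , _) = ⊥-elim (no-closing q₁ e)

  holonomy-closed : ∀ {x} (p : Star Adj x x) → holonomy p ≈ 1#
  holonomy-closed p with simplify p
  ... | _ , stop , eq           = ≈-sym eq
  ... | _ , step _ x≢x _ _ , eq = ⊥-elim (x≢x refl)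

  -- A simple path of two or more edges between adjacent vertices would close to a cycle, so the
  -- length of the path decides adjacency.
  adjacent? : ∀ {x y} → Star Adj x y → Dec (Adj x y)
  adjacent? p with simplify p
  ... | _ , stop , _               = no irreflexive
  ... | _ , step e _ _ stop , _    = yes e
  ... | _ , q@(step _ _ _ (step _ _ _ _)) , _ = no λ e → no-closing q (symm e)

-- Rooted forests, covering single trees and disjoint unions alike.

record IsForest {V : Set} {ℓ : Level} (Γ : Graph V ℓ) : Set ℓ where
  open Graph Γ
  field
    {size}      : ℕ
    treeOf      : V → Fin size
    root        : Fin size → V
    root-vertex : ∀ i → Vertex (root i)
    treeOf-root : ∀ i → treeOf (root i) ≡ i
    adj⇒same    : ∀ {x y} → Adj x y → treeOf x ≡ treeOf y
    connected   : ∀ {x y} → Vertex x → Vertex y → treeOf x ≡ treeOf y → Star Adj x y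
    acyclic     : ∀ x xs → ¬ IsCycle Γ x xs

module _ {V : Set} {ℓ : Level} {Γ : Graph V ℓ} where

  open Graph Γ

  tree⇒forest : IsTree Γ → IsForest Γ
  tree⇒forest T = record
    { size        = 1
    ; treeOf      = λ _ → zero
    ; root        = λ _ → proj₁ nonempty
    ; root-vertex = λ _ → proj₂ nonempty
    ; treeOf-root = λ { zero → refl }
    ; adj⇒same    = λ _ → refl
    ; connected   = λ p q _ → connected p q
    ; acyclic     = acyclic
    }
    where open IsTree T

  trees⇒forest : ∀ {k} → IsDisjointUnionOfTrees k Γ → IsForest Γ
  trees⇒forest T = record
    { treeOf      = treeOf
    ; root        = λ i → proj₁ (IsTree.nonempty (isTree i))
    ; root-vertex = λ i → proj₁ (proj₂ (IsTree.nonempty (isTree i)))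
    ; treeOf-root = λ i → proj₂ (proj₂ (IsTree.nonempty (isTree i)))
    ; adj⇒same    = adj⇒same
    ; connected   = λ p q eq →
        Star.gmap (λ x → x) proj₁ (IsTree.connected (isTree _) (p , eq) (q , refl))
    ; acyclic     = λ x xs (long , unique , linked) →
        IsTree.acyclic (isTree (treeOf x)) x xs (long , unique , within refl linked)
    }
    where
    open IsDisjointUnionOfTrees T
    within : ∀ {i xs} {x} → treeOf x ≡ i → Linked Adj (x ∷ xs) →
      Linked (Graph.Adj (induced Γ (λ y → treeOf y ≡ i))) (x ∷ xs)
    within eq [-]     = [-]
    within eq (e ∷ l) = (e , eq , eq′) ∷ within eq′ l
      where eq′ = ≡.trans (≡.sym (adj⇒same e)) eq

ℤ/2 : Group _ _
ℤ/2 = CommutativeRing.+-group xor-∧-commutativeRing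

-- Decidable membership and potentials on extension graphs.

module Extensions {ℓ : Level} {n : ℕ} (S : Pred (List (Fin n)) ℓ)
  (isFactorial : IsFactorial S) ([]∈S : [] ∈ S)
  (forest : ∀ {y} → y ∈ S → IsForest (extensionGraph S y)) where

  open IsFactorial isFactorial

  private
    A = Fin n
    W = List A

  infix-∈ : ∀ {a y b} → a ∷ y ∷ʳ b ∈ S → y ∈ S
  infix-∈ {a} {y} {b} p = factors [ a ] y [ b ] p

  prefix-∈ : ∀ u {v} → u ++ v ∈ S → u ∈ S
  prefix-∈ u {v} p = factors [] u v p

  suffix-∈ : ∀ u {v} → u ++ v ∈ S → v ∈ S
  suffix-∈ u {v} p = factors u v [] (subst (_∈ S) (cong (u ++_) (≡.sym (++-identityʳ v))) p)

  _≟ⱽ_ = ≡-dec (Fin._≟_ {n}) (Fin._≟_ {n})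

  irreflexive : ∀ {y x} → ¬ Edge S y x x
  irreflexive ()

  module _ {y : W} (y∈S : y ∈ S) where
    open IsForest (forest y∈S)
    open Walks _≟ⱽ_ (extensionGraph S y) irreflexive acyclic ℤ/2 (λ _ _ → false) (λ _ → refl)

    biextension? : ∀ a b → Dec (a ∷ y ∈ S) → Dec (y ∷ʳ b ∈ S) → Dec (a ∷ y ∷ʳ b ∈ S)
    biextension? a b (no ay∉S) _ = no λ p → ay∉S (prefix-∈ (a ∷ y) p)
    biextension? a b _ (no yb∉S) = no λ p → yb∉S (suffix-∈ [ a ] p)
    biextension? a b (yes ay∈S) (yes yb∈S) with treeOf (inj₁ a) Fin.≟ treeOf (inj₂ b)
    ... | no differ = no λ p → differ (adj⇒same (edge p))
    ... | yes same with adjacent? (connected (left ay∈S) (right yb∈S) same)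
    ... | yes (edge p) = yes p
    ... | no ¬e = no λ p → ¬e (edge p)

  private
    -- When `a ∷ y` and `y ∷ʳ b` lie in `S`, membership of `a ∷ y ∷ʳ b` is adjacency in a forest,
    -- hence decidable. The call on `a ∷ y` is not structural, so `k` bounds the length.
    member?′ : ∀ k w → length w ≤ k → Dec (w ∈ S)
    member?′ _ [] _ = yes []∈S
    member?′ (suc k) (a ∷ w) (s≤s le) with initLast w
    ... | []      = yes (letters a)
    ... | y ∷ʳ′ b with member?′ k (y ∷ʳ b) le
    ... | no yb∉S  = no λ p → yb∉S (suffix-∈ [ a ] p)
    ... | yes yb∈S = biextension? (prefix-∈ y yb∈S) a b (member?′ k (a ∷ y) (≤-trans ay≤yb le)) (yes yb∈S)
      where
      ay≤yb : length (a ∷ y) ≤ length (y ∷ʳ b)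
      ay≤yb = ≤-reflexive (≡.trans (+-comm 1 _) (≡.sym (length-++ y)))

  member? : ∀ w → Dec (w ∈ S)
  member? w = member?′ _ w ≤-refl

  module _ {c ℓ′ : Level} (H : Group c ℓ′) where

    open Group H using (Carrier; _≈_; _∙_; _⁻¹; assoc; ∙-congˡ; ∙-congʳ; inverseˡ; inverseʳ; identityˡ)
      renaming (ε to 1#; refl to ≈-refl; sym to ≈-sym; trans to ≈-trans)
    open SetoidReasoning (Group.setoid H)
    open GroupProperties H using (inverseˡ-unique)

    private
      weight : (A → A → Carrier) → A ⊎ A → A ⊎ A → Carrier
      weight lab (inj₁ a) (inj₂ b) = lab a b
      weight lab (inj₂ b) (inj₁ a) = lab a b ⁻¹
      weight lab (inj₁ _) (inj₁ _) = 1#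
      weight lab (inj₂ _) (inj₂ _) = 1#

      vertex? : ∀ y x → Dec (LRVertex S y x)
      vertex? y (inj₁ a) with member? (a ∷ y)
      ... | yes p = yes (left p)
      ... | no ¬p = no λ { (left p) → ¬p p }
      vertex? y (inj₂ b) with member? (y ∷ʳ b)
      ... | yes p = yes (right p)
      ... | no ¬p = no λ { (right p) → ¬p p }

    module _ {y : W} (y∈S : y ∈ S) (lab : A → A → Carrier) where
      open IsForest (forest y∈S)

      private
        weight-inverse : ∀ {u v} → Edge S y u v → weight lab u v ∙ weight lab v u ≈ 1#
        weight-inverse (edge _)  = inverseʳ _
        weight-inverse (edge⁻ _) = inverseˡ _

      open Walks _≟ⱽ_ (extensionGraph S y) irreflexive acyclic H (weight lab) weight-inverse

      -- Closed walks in a forest have trivial holonomy, so the holonomy of a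
      -- walk from the root depends on its end only.
      potential : A ⊎ A → Carrier
      potential x with vertex? y x
      ... | yes p = holonomy (connected (root-vertex (treeOf x)) p (treeOf-root _))
      ... | no  _ = 1#

      -- Followed by one walk from `v` back to the root, both the walk to `u` with the edge and the
      -- walk to `v` close up; so each is inverse to the same holonomy.
      potential-edge : ∀ {u v} → LRVertex S y u → LRVertex S y v → Edge S y u v →
        potential u ∙ weight lab u v ≈ potential v
      potential-edge {u} {v} u∈ v∈ e with vertex? y u | vertex? y v
      ... | no u∉ | _     = ⊥-elim (u∉ u∈)
      ... | yes _ | no v∉ = ⊥-elim (v∉ v∈)
      ... | yes u∈ | yes v∈ = ≈-trans (inverseˡ-unique _ _ closed₁) (≈-sym (inverseˡ-unique _ _ closed₂))
        where
        same : treeOf u ≡ treeOf v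
        same = adj⇒same e
        p = connected (root-vertex (treeOf u)) u∈ (treeOf-root _)
        q = connected (root-vertex (treeOf v)) v∈ (treeOf-root _)
        r = connected v∈ (root-vertex (treeOf v)) (≡.sym (treeOf-root _))
        r′ = subst (λ i → Star (Edge S y) v (root i)) (≡.sym same) r
        holonomy-subst : ∀ {i j} (eq : i ≡ j) (s : Star (Edge S y) v (root i)) →
          holonomy (subst (λ i → Star (Edge S y) v (root i)) eq s) ≡ holonomy s
        holonomy-subst refl s = refl
        closed₁ : (holonomy p ∙ weight lab u v) ∙ holonomy r ≈ 1#
        closed₁ = begin
          (holonomy p ∙ weight lab u v) ∙ holonomy r   ≈⟨ assoc _ _ _ ⟩
          holonomy p ∙ (weight lab u v ∙ holonomy r)   ≡⟨ cong (λ h → _ ∙ (_ ∙ h)) (holonomy-subst (≡.sym same) r) ⟨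
          holonomy p ∙ holonomy (e ◅ r′)               ≈⟨ holonomy-◅◅ p (e ◅ r′) ⟨
          holonomy (p ◅◅ e ◅ r′)                       ≈⟨ holonomy-closed (p ◅◅ e ◅ r′) ⟩
          1#                                           ∎
        closed₂ : holonomy q ∙ holonomy r ≈ 1#
        closed₂ = ≈-trans (≈-sym (holonomy-◅◅ q r)) (holonomy-closed (q ◅◅ r))

    -- On a forest every edge label is a coboundary: the potential satisfies π(a) lab(a, b) = π(b),
    -- which is solved for the label.
    splitLabel : ∀ y (lab : A → A → Carrier) →
      ∃₂ λ (α β : A → Carrier) → ∀ a b → a ∷ y ∷ʳ b ∈ S → lab a b ≈ α a ∙ β b
    splitLabel y lab with member? y
    ... | no y∉S  = (λ _ → 1#) , (λ _ → 1#) , λ a b p → ⊥-elim (y∉S (infix-∈ p))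
    ... | yes y∈S = (λ a → π (inj₁ a) ⁻¹) , (λ b → π (inj₂ b)) , λ a b p → begin
          lab a b                                   ≈⟨ identityˡ _ ⟨
          1# ∙ lab a b                              ≈⟨ ∙-congʳ (inverseˡ _) ⟨
          (π (inj₁ a) ⁻¹ ∙ π (inj₁ a)) ∙ lab a b    ≈⟨ assoc _ _ _ ⟩
          π (inj₁ a) ⁻¹ ∙ (π (inj₁ a) ∙ lab a b)    ≈⟨ ∙-congˡ (potential-edge y∈S lab
               (left (prefix-∈ (a ∷ y) p)) (right (suffix-∈ [ a ] p)) (edge p)) ⟩
          π (inj₁ a) ⁻¹ ∙ π (inj₂ b)                ∎
      where π = potential y∈S lab

-- Suffixes, prefixes and occurrences of factors.

module _ {A : Set} where

  length-∷ʳ : (u : List A) (a : A) → length (u ∷ʳ a) ≡ suc (length u)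
  length-∷ʳ u a = ≡.trans (length-++ u) (+-comm _ 1)

  length-++≤ : ∀ (a b : List A) → length b ≤ length (a ++ b)
  length-++≤ a b = ≤-trans (m≤n+m _ (length a)) (≤-reflexive (≡.sym (length-++ a)))

  suffix-comparable : ∀ (a c : List A) {b d} → a ++ b ≡ c ++ d → length d ≤ length b →
    ∃ λ e → b ≡ e ++ d
  suffix-comparable []      c eq le = c , eq
  suffix-comparable (x ∷ a) (y ∷ c) eq le = suffix-comparable a c (∷-injectiveʳ eq) le
  suffix-comparable (x ∷ a) [] {b} {d} eq le = ⊥-elim (<-irrefl refl (≤-trans b<d le))
    where
    b<d : length b < length d
    b<d = subst (length b <_) (cong length eq) (s≤s (length-++≤ a b))

  prefixOf? : DecidableEquality A → ∀ w (y : List A) → Dec (∃ λ v → y ≡ w ++ v)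
  prefixOf? _   []      y  = yes (y , refl)
  prefixOf? _   (_ ∷ _) [] = no λ ()
  prefixOf? dec (c ∷ w) (a ∷ y) with dec a c | prefixOf? dec w y
  ... | no a≢c   | _              = no λ (_ , eq) → a≢c (∷-injectiveˡ eq)
  ... | yes _    | no ¬p          = no λ (v , eq) → ¬p (v , ∷-injectiveʳ eq)
  ... | yes refl | yes (v , refl) = yes (v , refl)

  Contains : List A → List A → Set
  Contains w y = ∃₂ λ u v → y ≡ u ++ w ++ v

  contains? : DecidableEquality A → ∀ w y → Dec (Contains w y)
  contains? dec w y with prefixOf? dec w y
  contains? dec w y | yes (v , eq) = yes ([] , v , eq)
  contains? dec w [] | no ¬p = no λ { ([] , v , eq) → ¬p (v , eq) }
  contains? dec w (a ∷ y) | no ¬p with contains? dec w y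
  ... | yes (u , v , eq) = yes (a ∷ u , v , cong (a ∷_) eq)
  ... | no ¬c = no λ { ([] , v , eq) → ¬p (v , eq) ; (_ ∷ u , v , eq) → ¬c (u , v , ∷-injectiveʳ eq) }

  contains-∷ : ∀ {w y} a → Contains w y → Contains w (a ∷ y)
  contains-∷ a (u , v , eq) = a ∷ u , v , cong (a ∷_) eq

  contains-∷ʳ : ∀ {w y} b → Contains w y → Contains w (y ∷ʳ b)
  contains-∷ʳ {w} b (u , v , refl) = u , v ∷ʳ b ,
    ≡.trans (++-assoc u (w ++ v) [ b ]) (cong (u ++_) (++-assoc w v [ b ]))

-- Labels and the lowering of their order.

module Labels {ℓ : Level} {n : ℕ} (S : Pred (List (Fin n)) ℓ)
  (isFactorial : IsFactorial S) ([]∈S : [] ∈ S)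
  (forest : ∀ {y} → y ∈ S → IsForest (extensionGraph S y))
  {c ℓ′ : Level} (H : Group c ℓ′) (w : List (Fin n)) where

  open IsFactorial isFactorial
  open Extensions S isFactorial []∈S forest
  open Group H
    using (Carrier; _≈_; _∙_; _⁻¹; assoc; ∙-cong; ∙-congˡ; ∙-congʳ; inverseˡ; identityˡ; identityʳ; ⁻¹-cong)
    renaming (ε to 1#; refl to ≈-refl; sym to ≈-sym; trans to ≈-trans; reflexive to ≈-reflexive)
  open SetoidReasoning (Group.setoid H)
  open GroupProperties H

  private
    A = Fin n
    W = List A

  -- A label weights the letter following a history.
  Label : Set c
  Label = W → A → Carrier

  -- Letters in front of a good history may be forgotten. Containing `w` counts as good so that the
  -- gauge takes one value at all histories ending with `w`.
  Good : ℕ → W → Set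
  Good k y = k ≤ length y ⊎ Contains w y

  good? : ∀ k y → Dec (Good k y)
  good? k y = (k ≤? length y) ⊎-dec contains? Fin._≟_ w y

  good-∷ : ∀ {k y} a → Good k y → Good k (a ∷ y)
  good-∷ a (inj₁ le) = inj₁ (m≤n⇒m≤1+n le)
  good-∷ a (inj₂ co) = inj₂ (contains-∷ a co)

  good-∷ʳ : ∀ {k y} b → Good k y → Good k (y ∷ʳ b)
  good-∷ʳ {k} {y} b (inj₁ le) = inj₁ (subst (k ≤_) (≡.sym (length-∷ʳ y b)) (m≤n⇒m≤1+n le))
  good-∷ʳ b (inj₂ co) = inj₂ (contains-∷ʳ b co)

  -- Only the last k letters of the history matter, or fewer if they contain w.
  HasOrder : ℕ → Label → Set _
  HasOrder k lab = ∀ a y b → a ∷ y ∷ʳ b ∈ S → Good k y → lab (a ∷ y) b ≈ lab y b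

  product : Label → W → W → Carrier
  product lab x []      = 1#
  product lab x (b ∷ v) = lab x b ∙ product lab (x ∷ʳ b) v

  -- The tree condition factors lab (a y) b as α(a) β(b) for every y of length
  -- k; moving α from the letter leaving a y to the letters entering it makes
  -- the label independent of a.
  module Descent (k : ℕ) (lab : Label) (lab-order : HasOrder (suc k) lab) where

    private
      α β : W → A → Carrier
      α y = proj₁ (splitLabel H y (λ a b → lab (a ∷ y) b))
      β y = proj₁ (proj₂ (splitLabel H y (λ a b → lab (a ∷ y) b)))

      αβ : ∀ y a b → a ∷ y ∷ʳ b ∈ S → lab (a ∷ y) b ≈ α y a ∙ β y b
      αβ y = proj₂ (proj₂ (splitLabel H y (λ a b → lab (a ∷ y) b)))

    -- Letters are stripped until what follows the first one is no longer good. If that rest has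
    -- length `k`, the first letter carries `α`; if it is shorter, the value is 1.
    gauge : W → Carrier
    gauge [] = 1#
    gauge (a ∷ x) with good? (suc k) x
    ... | yes _ = gauge x
    ... | no _  with length x ≟ k
    ... | yes _ = α x a
    ... | no _  = 1#

    gauge-good : ∀ a x → Good (suc k) x → gauge (a ∷ x) ≡ gauge x
    gauge-good a x good with good? (suc k) x
    ... | yes _  = refl
    ... | no bad = ⊥-elim (bad good)

    gauge-length : ∀ a x → ¬ Good (suc k) x → length x ≡ k → gauge (a ∷ x) ≡ α x a
    gauge-length a x bad eq with good? (suc k) x
    ... | yes good = ⊥-elim (bad good)
    ... | no _ with length x ≟ k
    ... | yes _ = refl
    ... | no ≢k = ⊥-elim (≢k eq)

    gauge-contains : ∀ h x → Contains w x → gauge (h ++ x) ≡ gauge x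
    gauge-contains []      x co = refl
    gauge-contains (a ∷ h) x co = ≡.trans (gauge-good a (h ++ x) (inj₂ (extend h))) (gauge-contains h x co)
      where
      extend : ∀ h → Contains w (h ++ x)
      extend []      = co
      extend (a ∷ h) = contains-∷ a (extend h)

    -- At a bad history there may be no letter in front to supply `α`; `β` is what remains of `lab`
    -- once `α` has been moved away.
    descended : Label
    descended x b with good? (suc k) x
    ... | yes _ = gauge x ⁻¹ ∙ lab x b ∙ gauge (x ∷ʳ b)
    ... | no _  = β x b ∙ gauge (x ∷ʳ b)

    descended-good : ∀ {x} b → Good (suc k) x →
      descended x b ≡ gauge x ⁻¹ ∙ lab x b ∙ gauge (x ∷ʳ b)
    descended-good {x} b good with good? (suc k) x
    ... | yes _  = refl
    ... | no bad = ⊥-elim (bad good)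

    descended-order : HasOrder k descended
    descended-order a y b p good with good? (suc k) y
    ... | yes good′ = ≈-trans (≈-reflexive (descended-good b (good-∷ a good′)))
          (∙-cong (∙-cong (⁻¹-cong (≈-reflexive (gauge-good a y good′))) (lab-order a y b p good′))
            (≈-reflexive (gauge-good a (y ∷ʳ b) (good-∷ʳ b good′))))
    descended-order a y b p (inj₂ co) | no bad = ⊥-elim (bad (inj₂ co))
    -- The new case: `y` has length exactly `k` and omits `w`. Here `α` cancels against the gauge at
    -- `a ∷ y`, and what is left does not depend on `a`.
    descended-order a y b p (inj₁ k≤) | no bad = begin
      descended (a ∷ y) b
        ≡⟨ descended-good b (inj₁ (s≤s k≤)) ⟩
      gauge (a ∷ y) ⁻¹ ∙ lab (a ∷ y) b ∙ gauge (a ∷ y ∷ʳ b)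
        ≈⟨ ∙-cong (∙-cong (⁻¹-cong (≈-reflexive (gauge-length a y bad y≡k))) (αβ y a b p))
             (≈-reflexive (gauge-good a (y ∷ʳ b) (inj₁ (subst (suc k ≤_) (≡.sym (length-∷ʳ y b)) (s≤s k≤))))) ⟩
      α y a ⁻¹ ∙ (α y a ∙ β y b) ∙ gauge (y ∷ʳ b)
        ≈⟨ ∙-congʳ (\\-leftDividesʳ _ _) ⟩
      β y b ∙ gauge (y ∷ʳ b) ∎
      where
      y≡k : length y ≡ k
      y≡k with length y ≟ k
      ... | yes eq = eq
      ... | no ≢k  = ⊥-elim (bad (inj₁ (≤∧≢⇒< k≤ (≢k ∘ ≡.sym))))

    -- Successive gauges telescope, because every history from `x` on contains `w` and is therefore
    -- good.
    product-descended : ∀ x v → Contains w x →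
      product descended x v ≈ gauge x ⁻¹ ∙ product lab x v ∙ gauge (x ++ v)
    product-descended x [] co = begin
      1#                                     ≈⟨ inverseˡ _ ⟨
      gauge x ⁻¹ ∙ gauge x                   ≡⟨ cong (λ z → gauge x ⁻¹ ∙ gauge z) (++-identityʳ x) ⟨
      gauge x ⁻¹ ∙ gauge (x ++ [])           ≈⟨ ∙-congʳ (identityʳ _) ⟨
      gauge x ⁻¹ ∙ 1# ∙ gauge (x ++ [])      ∎
    product-descended x (b ∷ v) co = begin
      descended x b ∙ product descended (x ∷ʳ b) v
        ≈⟨ ∙-cong (≈-reflexive (descended-good b (inj₂ co))) (product-descended (x ∷ʳ b) v (contains-∷ʳ b co)) ⟩
      (gauge x ⁻¹ ∙ lab x b ∙ g) ∙ (g ⁻¹ ∙ product lab (x ∷ʳ b) v ∙ gauge ((x ∷ʳ b) ++ v))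
        ≡⟨ cong (λ z → (gauge x ⁻¹ ∙ lab x b ∙ g) ∙ (g ⁻¹ ∙ product lab (x ∷ʳ b) v ∙ gauge z))
             (++-assoc x [ b ] v) ⟩
      (gauge x ⁻¹ ∙ lab x b ∙ g) ∙ (g ⁻¹ ∙ product lab (x ∷ʳ b) v ∙ gauge (x ++ b ∷ v))
        ≈⟨ assoc _ _ _ ⟩
      (gauge x ⁻¹ ∙ lab x b) ∙ (g ∙ (g ⁻¹ ∙ product lab (x ∷ʳ b) v ∙ gauge (x ++ b ∷ v)))
        ≈⟨ ∙-congˡ (∙-congˡ (assoc _ _ _)) ⟩
      (gauge x ⁻¹ ∙ lab x b) ∙ (g ∙ (g ⁻¹ ∙ (product lab (x ∷ʳ b) v ∙ gauge (x ++ b ∷ v))))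
        ≈⟨ ∙-congˡ (\\-leftDividesˡ _ _) ⟩
      (gauge x ⁻¹ ∙ lab x b) ∙ (product lab (x ∷ʳ b) v ∙ gauge (x ++ b ∷ v))
        ≈⟨ assoc _ _ _ ⟨
      ((gauge x ⁻¹ ∙ lab x b) ∙ product lab (x ∷ʳ b) v) ∙ gauge (x ++ b ∷ v)
        ≈⟨ ∙-congʳ (assoc _ _ _) ⟩
      gauge x ⁻¹ ∙ product lab x (b ∷ v) ∙ gauge (x ++ b ∷ v) ∎
      where g = gauge (x ∷ʳ b)

  IsLoop : W → Set
  IsLoop r = ∃ λ h → w ++ r ≡ h ++ w

  -- After a loop the history again ends with `w` and has the same gauge, so each descent only
  -- conjugates the product; `d` collects the conjugators.
  descend : ∀ k lab → HasOrder k lab →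
    ∃₂ λ (lab₀ : Label) (d : Carrier) → HasOrder 0 lab₀ ×
      (∀ r → IsLoop r → product lab w r ≈ d ∙ product lab₀ w r ∙ d ⁻¹)
  descend zero lab order = lab , 1# , order , λ r _ →
    ≈-sym (≈-trans (∙-cong (identityˡ _) ε⁻¹≈ε) (identityʳ _))
  descend (suc k) lab order =
    let lab₀ , d , order₀ , conj = descend k descended descended-order in
    lab₀ , gauge w ∙ d , order₀ , λ r (h , loop) → begin
      product lab w r
        ≈⟨ unconjugate (gauge w) _ ⟩
      gauge w ∙ (gauge w ⁻¹ ∙ product lab w r ∙ gauge w) ∙ gauge w ⁻¹
        ≡⟨ cong (λ z → gauge w ∙ (gauge w ⁻¹ ∙ product lab w r ∙ z) ∙ gauge w ⁻¹)
             (≡.trans (cong gauge loop) (gauge-contains h w w∋w)) ⟨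
      gauge w ∙ (gauge w ⁻¹ ∙ product lab w r ∙ gauge (w ++ r)) ∙ gauge w ⁻¹
        ≈⟨ ∙-congʳ (∙-congˡ (product-descended w r w∋w)) ⟨
      gauge w ∙ product descended w r ∙ gauge w ⁻¹
        ≈⟨ ∙-congʳ (∙-congˡ (conj r (h , loop))) ⟩
      gauge w ∙ (d ∙ product lab₀ w r ∙ d ⁻¹) ∙ gauge w ⁻¹
        ≈⟨ ∙-congʳ (≈-trans (≈-sym (assoc _ _ _)) (∙-congʳ (≈-sym (assoc _ _ _)))) ⟩
      ((gauge w ∙ d) ∙ product lab₀ w r ∙ d ⁻¹) ∙ gauge w ⁻¹
        ≈⟨ assoc _ _ _ ⟩
      (gauge w ∙ d) ∙ product lab₀ w r ∙ (d ⁻¹ ∙ gauge w ⁻¹)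
        ≈⟨ ∙-congˡ (⁻¹-anti-homo-∙ _ _) ⟨
      (gauge w ∙ d) ∙ product lab₀ w r ∙ (gauge w ∙ d) ⁻¹ ∎
    where
    open Descent k lab order
    w∋w : Contains w w
    w∋w = [] , [] , ≡.sym (++-identityʳ w)
    unconjugate : ∀ g x → x ≈ g ∙ (g ⁻¹ ∙ x ∙ g) ∙ g ⁻¹
    unconjugate g x = begin
      x                               ≈⟨ //-rightDividesʳ _ _ ⟨
      x ∙ g ∙ g ⁻¹                    ≈⟨ ∙-congʳ (\\-leftDividesˡ _ _) ⟨
      g ∙ (g ⁻¹ ∙ (x ∙ g)) ∙ g ⁻¹     ≈⟨ ∙-congʳ (∙-congˡ (assoc _ _ _)) ⟨
      g ∙ (g ⁻¹ ∙ x ∙ g) ∙ g ⁻¹       ∎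

-- Multiplicative extension of maps on letters.

module _ {c ℓ : Level} (H : Group c ℓ) {A : Set} where

  open Group H renaming (ε to 1#)

  extend : (A → Carrier) → List A → Carrier
  extend f []      = 1#
  extend f (a ∷ v) = f a ∙ extend f v

  extend-++ : ∀ f u v → extend f (u ++ v) ≈ extend f u ∙ extend f v
  extend-++ f []      v = sym (identityˡ _)
  extend-++ f (a ∷ u) v = trans (∙-congˡ (extend-++ f u v)) (sym (assoc _ _ _))

  extend-conjugate : ∀ d f v → extend (λ a → d ∙ f a ∙ d ⁻¹) v ≈ d ∙ extend f v ∙ d ⁻¹
  extend-conjugate d f [] = sym (trans (∙-congʳ (identityʳ d)) (inverseʳ d))
  extend-conjugate d f (a ∷ v) = begin
    (d ∙ f a ∙ d ⁻¹) ∙ extend (λ a → d ∙ f a ∙ d ⁻¹) v   ≈⟨ ∙-congˡ (extend-conjugate d f v) ⟩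
    (d ∙ f a ∙ d ⁻¹) ∙ (d ∙ extend f v ∙ d ⁻¹)           ≈⟨ assoc _ _ _ ⟩
    (d ∙ f a) ∙ (d ⁻¹ ∙ (d ∙ extend f v ∙ d ⁻¹))         ≈⟨ ∙-congˡ (∙-congˡ (assoc _ _ _)) ⟩
    (d ∙ f a) ∙ (d ⁻¹ ∙ (d ∙ (extend f v ∙ d ⁻¹)))       ≈⟨ ∙-congˡ (\\-leftDividesʳ _ _) ⟩
    (d ∙ f a) ∙ (extend f v ∙ d ⁻¹)                      ≈⟨ assoc _ _ _ ⟨
    (d ∙ f a) ∙ extend f v ∙ d ⁻¹                        ≈⟨ ∙-congʳ (assoc _ _ _) ⟩
    d ∙ (f a ∙ extend f v) ∙ d ⁻¹                        ∎
    where
    open SetoidReasoning setoid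
    open GroupProperties H

-- Prescribed values on return words.

module Realization {ℓ : Level} {n : ℕ} (S : Pred (List (Fin n)) ℓ)
  (isFactorial : IsFactorial S) ([]∈S : [] ∈ S)
  (forest : ∀ {y} → y ∈ S → IsForest (extensionGraph S y))
  (c₀ : Fin n) (w′ : List (Fin n)) where

  private
    A = Fin n
    W = List A
    w : W
    w = c₀ ∷ w′

  return≢[] : ∀ {r} → RightReturn S w r → r ≢ []
  return≢[] p refl with IsCompleteReturn.properPrefix p
  ... | u , u≢[] , eq = u≢[] (≡.sym (++-cancelˡ w _ _ eq))

  module _ {c ℓ′ : Level} (H : Group c ℓ′) (val : Σ W (RightReturn S w) → Group.Carrier H)
    (val-cong : ∀ {x y} → proj₁ x ≡ proj₁ y → Group._≈_ H (val x) (val y)) where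

    open Group H using (Carrier; _≈_; _∙_; _⁻¹; ∙-cong; ∙-congˡ; ∙-congʳ; identityˡ; identityʳ)
      renaming (ε to 1#; refl to ≈-refl; sym to ≈-sym; trans to ≈-trans)
    open SetoidReasoning (Group.setoid H)
    open Extensions S isFactorial []∈S forest using (prefix-∈; suffix-∈)
    open Labels S isFactorial []∈S forest H w

    -- Only the finitely many listed return words carry a value, which bounds the order of the label
    -- built from them.
    value : List (Σ W (RightReturn S w)) → W → Carrier
    value []       x = 1#
    value (g ∷ gs) x with List.≡-dec Fin._≟_ (w ++ proj₁ g) x
    ... | yes _ = val g
    ... | no _  = value gs x

    value-support : ∀ gs x → value gs x ≈ 1# ⊎ IsCompleteReturn S w x
    value-support []       x = inj₁ ≈-refl
    value-support (g ∷ gs) x with List.≡-dec Fin._≟_ (w ++ proj₁ g) x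
    ... | yes refl = inj₂ (proj₂ g)
    ... | no _     = value-support gs x

    bound : List (Σ W (RightReturn S w)) → ℕ
    bound []       = 0
    bound (g ∷ gs) = length (w ++ proj₁ g) ⊔ bound gs

    value-bounded : ∀ gs x → bound gs < length x → value gs x ≈ 1#
    value-bounded []       x lt = ≈-refl
    value-bounded (g ∷ gs) x lt with List.≡-dec Fin._≟_ (w ++ proj₁ g) x
    ... | yes refl = ⊥-elim (<-irrefl refl (≤-trans (s≤s (m≤m⊔n _ (bound gs))) lt))
    ... | no _     = value-bounded gs x (≤-trans (s≤s (m≤n⊔m (length (w ++ proj₁ g)) _)) lt)

    value-∈ : ∀ gs {g} → g List.∈ gs → value gs (w ++ proj₁ g) ≈ val g
    value-∈ (g′ ∷ gs) {g} g∈ with List.≡-dec Fin._≟_ (w ++ proj₁ g′) (w ++ proj₁ g)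
    value-∈ (g′ ∷ gs) g∈ | yes eq = val-cong (++-cancelˡ w _ _ eq)
    value-∈ (g′ ∷ gs) (here refl) | no ≢ = ⊥-elim (≢ refl)
    value-∈ (g′ ∷ gs) (there g∈)  | no _ = value-∈ gs g∈

    module _ (gs : List (Σ W (RightReturn S w))) where

      -- The product of the values of all suffixes; at most one of them is a
      -- complete return word.
      returnLabel : Label
      returnLabel []      b = 1#
      returnLabel (a ∷ x) b = value gs (a ∷ x ∷ʳ b) ∙ returnLabel x b

      -- If `a ∷ y ∷ʳ b` is longer than all listed words, its value is 1. If `y` contains `w`, then
      -- `w` is internal to `a ∷ y ∷ʳ b`, which is thus no complete return word.
      returnLabel-order : HasOrder (bound gs) returnLabel
      returnLabel-order a y b p good = ≈-trans (∙-congʳ (trivial good)) (identityˡ _)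
        where
        trivial : Good (bound gs) y → value gs (a ∷ y ∷ʳ b) ≈ 1#
        trivial (inj₁ le) = value-bounded gs _ (s≤s (≤-trans le (≤-trans (n≤1+n _) (≤-reflexive (≡.sym (length-∷ʳ y b))))))
        trivial (inj₂ (u , v , refl)) with value-support gs (a ∷ y ∷ʳ b)
        ... | inj₁ eq = eq
        ... | inj₂ cr = ⊥-elim (IsCompleteReturn.notInternal cr
              (a ∷ u , v ∷ʳ b , (λ ()) , ∷ʳ-≢[] v , cong (a ∷_)
                (≡.trans (++-assoc u (w ++ v) [ b ]) (cong (u ++_) (++-assoc w v [ b ])))))
          where
          ∷ʳ-≢[] : ∀ v → v ∷ʳ b ≢ []
          ∷ʳ-≢[] []      ()
          ∷ʳ-≢[] (_ ∷ _) ()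

      returnLabel-trivial : ∀ x b → (∀ e s → x ≡ e ++ s → ¬ IsCompleteReturn S w (s ∷ʳ b)) →
        returnLabel x b ≈ 1#
      returnLabel-trivial []      b _ = ≈-refl
      returnLabel-trivial (a ∷ x) b none with value-support gs (a ∷ x ∷ʳ b)
      ... | inj₁ eq = ≈-trans (∙-cong eq (returnLabel-trivial x b (λ e s x≡ → none (a ∷ e) s (cong (a ∷_) x≡)))) (identityˡ _)
      ... | inj₂ cr = ⊥-elim (none [] (a ∷ x) refl cr)

      -- A complete return word contributes at its last letter only: another one that ended earlier
      -- or started later would put an occurrence of `w` inside it.
      product-return : ∀ q v → v ≢ [] → IsCompleteReturn S w (w ++ q ++ v) →
        product returnLabel (w ++ q) v ≈ value gs (w ++ q ++ v)
      product-return q [] v≢[] cr = ⊥-elim (v≢[] refl)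
      product-return q (b ∷ v) _ cr = go v cr
        where
        later-trivial : ∀ v → IsCompleteReturn S w (w ++ q ++ b ∷ v) → returnLabel (w′ ++ q) b ≈ 1#
        later-trivial v cr = returnLabel-trivial (w′ ++ q) b λ e s eq cr′ →
          let u , u≢[] , s≡ = IsCompleteReturn.properPrefix cr′ in
          IsCompleteReturn.notInternal cr
            ( c₀ ∷ e , u ++ v , (λ ()) , (λ uv≡[] → u≢[] (++-conicalˡ′ u v uv≡[]))
            , cong (c₀ ∷_) (≡.trans (≡.sym (++-assoc w′ q (b ∷ v)))
                (≡.trans (cong (_++ b ∷ v) eq) (≡.trans (++-assoc e s (b ∷ v))
                  (cong (e ++_) (≡.trans (≡.sym (++-assoc s [ b ] v))
                    (≡.trans (cong (_++ v) s≡) (++-assoc w u v))))))))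
          where
          ++-conicalˡ′ : ∀ (u v : W) → u ++ v ≡ [] → u ≡ []
          ++-conicalˡ′ [] v eq = refl
        go : ∀ v → IsCompleteReturn S w (w ++ q ++ b ∷ v) →
          product returnLabel (w ++ q) (b ∷ v) ≈ value gs (w ++ q ++ b ∷ v)
        go [] cr = begin
          (value gs (c₀ ∷ (w′ ++ q) ∷ʳ b) ∙ returnLabel (w′ ++ q) b) ∙ 1#  ≈⟨ identityʳ _ ⟩
          value gs (c₀ ∷ (w′ ++ q) ∷ʳ b) ∙ returnLabel (w′ ++ q) b         ≈⟨ ∙-congˡ (later-trivial [] cr) ⟩
          value gs (c₀ ∷ (w′ ++ q) ∷ʳ b) ∙ 1#                              ≈⟨ identityʳ _ ⟩
          value gs (c₀ ∷ (w′ ++ q) ∷ʳ b)                                   ≡⟨ cong (value gs) (++-assoc w q [ b ]) ⟩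
          value gs (w ++ q ∷ʳ b)                                           ∎
        go v@(b′ ∷ v′) cr = begin
          (value gs (c₀ ∷ (w′ ++ q) ∷ʳ b) ∙ returnLabel (w′ ++ q) b) ∙ product returnLabel ((w ++ q) ∷ʳ b) v
            ≈⟨ ∙-congʳ (∙-cong now-trivial (later-trivial v cr)) ⟩
          (1# ∙ 1#) ∙ product returnLabel ((w ++ q) ∷ʳ b) v
            ≈⟨ ≈-trans (∙-congʳ (identityˡ _)) (identityˡ _) ⟩
          product returnLabel ((w ++ q) ∷ʳ b) v
            ≡⟨ cong (λ x → product returnLabel x v) (++-assoc w q [ b ]) ⟩
          product returnLabel (w ++ q ∷ʳ b) v
            ≈⟨ product-return (q ∷ʳ b) v (λ ()) (subst (IsCompleteReturn S w) (cong (w ++_) shift) cr) ⟩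
          value gs (w ++ (q ∷ʳ b) ++ v)
            ≡⟨ cong (λ x → value gs (w ++ x)) shift ⟨
          value gs (w ++ q ++ b ∷ v) ∎
          where
          shift : q ++ b ∷ v ≡ (q ∷ʳ b) ++ v
          shift = ≡.sym (++-assoc q [ b ] v)
          now-trivial : value gs (c₀ ∷ (w′ ++ q) ∷ʳ b) ≈ 1#
          now-trivial with value-support gs (c₀ ∷ (w′ ++ q) ∷ʳ b)
          ... | inj₁ eq = eq
          ... | inj₂ cr′ =
            let u , u≢[] , eq = IsCompleteReturn.properSuffix cr′ in
            ⊥-elim (IsCompleteReturn.notInternal cr (u , v , u≢[] , (λ ())
              , (≡.trans (≡.trans (≡.sym (++-assoc w q (b ∷ v))) (≡.sym (++-assoc (w ++ q) [ b ] v)))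
                   (≡.trans (cong (_++ v) eq) (++-assoc u w v)))))

      product-letters : ∀ lab → HasOrder 0 lab → ∀ x v → x ++ v ∈ S →
        product lab x v ≈ extend H (lab []) v
      product-letters lab order x []      p = ≈-refl
      product-letters lab order x (b ∷ v) p =
        ∙-cong (forget x (prefix-∈ (x ∷ʳ b) p′)) (product-letters lab order (x ∷ʳ b) v p′)
        where
        p′ = subst (_∈ S) (≡.sym (++-assoc x [ b ] v)) p
        forget : ∀ x → x ∷ʳ b ∈ S → lab x b ≈ lab [] b
        forget []      p = ≈-refl
        forget (a ∷ x) p = ≈-trans (order a x b p (inj₁ z≤n)) (forget x (suffix-∈ [ a ] p))

      -- At order 0 the return label is a map on letters; the conjugator `d` of the descent is
      -- absorbed into the values of this map.
      realize : ∃ λ (f : A → Carrier) → ∀ {g} → g List.∈ gs → extend H f (proj₁ g) ≈ val g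
      realize =
        let lab , d , order , conj = descend (bound gs) returnLabel returnLabel-order in
        (λ a → d ∙ lab [] a ∙ d ⁻¹) , λ {g} g∈ →
          let r , cr = g
              h , _ , loop = IsCompleteReturn.properSuffix cr in begin
          extend H (λ a → d ∙ lab [] a ∙ d ⁻¹) r  ≈⟨ extend-conjugate H d (lab []) r ⟩
          d ∙ extend H (lab []) r ∙ d ⁻¹          ≈⟨ ∙-congʳ (∙-congˡ (product-letters lab order w r (IsCompleteReturn.member cr))) ⟨
          d ∙ product lab w r ∙ d ⁻¹              ≈⟨ conj r (h , loop) ⟨
          product returnLabel w r                 ≡⟨ cong (λ x → product returnLabel x r) (++-identityʳ w) ⟨
          product returnLabel (w ++ []) r         ≈⟨ product-return [] r (return≢[] cr) cr ⟩
          value gs (w ++ r)                       ≈⟨ value-∈ gs g∈ ⟩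
          val g                                   ∎

-- Finite search and counting.

module _ {A : Set} where

  prefix-comparable : ∀ (a c : List A) {b d} → a ++ b ≡ c ++ d → length a ≤ length c →
    ∃ λ e → c ≡ a ++ e × b ≡ e ++ d
  prefix-comparable []      c       eq le       = c , refl , eq
  prefix-comparable (x ∷ a) (y ∷ c) eq (s≤s le) with ∷-injective eq
  ... | refl , eq′ with prefix-comparable a c eq′ le
  ... | e , refl , b≡ = e , refl , b≡

  length-≤++ : ∀ (a b : List A) → length a ≤ length (a ++ b)
  length-≤++ a b = ≤-trans (m≤m+n _ (length b)) (≤-reflexive (≡.sym (length-++ a)))

searchWords : ∀ {ℓ n} {P : Pred (List (Fin n)) ℓ} → Decidable P → ∀ m →
  (∃ λ x → length x ≡ m × P x) ⊎ (∀ x → length x ≡ m → ¬ P x)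
searchWords P? zero with P? []
... | yes p = inj₁ ([] , refl , p)
... | no ¬p = inj₂ λ { [] _ → ¬p }
searchWords {P = P} P? (suc m) with Fin.any? (λ a → found? (searchWords (λ x → P? (a ∷ x)) m))
  where
  found? : ∀ {a} → (∃ λ x → length x ≡ m × P (a ∷ x)) ⊎ (∀ x → length x ≡ m → ¬ P (a ∷ x)) →
    Dec (∃ λ x → length x ≡ m × P (a ∷ x))
  found? (inj₁ x)    = yes x
  found? (inj₂ none) = no λ (x , eq , p) → none x eq p
... | yes (a , x , eq , p) = inj₁ (a ∷ x , cong suc eq , p)
... | no none = inj₂ λ { (a ∷ x) refl p → none (a , x , refl , p) }

funToFin-cong : ∀ {m n} {f g : Fin m → Fin n} → f ≗ g → funToFin f ≡ funToFin g
funToFin-cong {zero}  eq = refl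
funToFin-cong {suc m} eq = cong₂ combine (eq zero) (funToFin-cong (eq ∘ suc))

pigeonhole-functions : ∀ {m n} → n < m → (F : (Fin m → Bool) → Fin n → Bool) →
  ∃₂ λ e e′ → ¬ (e ≗ e′) × F e ≗ F e′
pigeonhole-functions {m} {n} n<m F =
  let i , j , i<j , eq = Fin.pigeonhole (^-monoʳ-< 2 ≤-refl n<m) (λ k → funToFin (from ∘ F (to ∘ finToFun k)))
  in to ∘ finToFun i , to ∘ finToFun j
     , (λ same → Fin.<⇒≢ i<j (≡.trans (≡.sym (Fin.funToFin-finToFin {m} i))
          (≡.trans (funToFin-cong (injective ∘ same)) (Fin.funToFin-finToFin {m} j))))
     , λ k → ≡.trans (≡.sym (strictlyInverseˡ _)) (≡.trans (cong to
          (≡.trans (≡.sym (Fin.finToFun-funToFin _ k)) (≡.trans (cong (λ z → finToFun z k) eq) (Fin.finToFun-funToFin _ k))))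
          (strictlyInverseˡ _))
  where
  open Inverse Fin.2↔Bool
  injective : ∀ {x y} → to x ≡ to y → x ≡ y
  injective eq = ≡.trans (≡.sym (strictlyInverseʳ _)) (≡.trans (cong from eq) (strictlyInverseʳ _))

-- First returns and uniform recurrence.

module Returns {ℓ : Level} {n : ℕ} (S : Pred (List (Fin n)) ℓ)
  (isRecurrent : IsRecurrent S)
  (forest : ∀ {y} → y ∈ S → IsForest (extensionGraph S y))
  (c₀ : Fin n) (w′ : List (Fin n)) (w∈S : c₀ ∷ w′ ∈ S) where

  open IsRecurrent isRecurrent

  private
    A = Fin n
    W = List A
    w : W
    w = c₀ ∷ w′

  []∈S : [] ∈ S
  []∈S = IsFactorial.factors isFactorial [] [] w w∈S

  open Extensions S isFactorial []∈S forest
  open Realization S isFactorial []∈S forest c₀ w′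

  private
    -- An internal occurrence of `w` in `w ++ q` ends a shorter prefix of the same kind; when there
    -- is none, `q` is a return word.
    firstReturn′ : ∀ k q d → length q ≤ k → q ≢ [] → w ++ q ∈ S → w ++ q ≡ d ++ w →
      ∃₂ λ r z → RightReturn S w r × q ≡ r ++ z
    firstReturn′ k q d le q≢[] p eq with initLast q
    ... | [] = ⊥-elim (q≢[] refl)
    -- Removing the first and the last letter of `w ++ q` leaves exactly the internal occurrences of
    -- `w`.
    ... | q′ ∷ʳ′ b with contains? Fin._≟_ w (w′ ++ q′)
    firstReturn′ k _ d le q≢[] p eq | q′ ∷ʳ′ b | no ¬inner =
      q′ ∷ʳ b , [] , record
        { member       = p
        ; properPrefix = q′ ∷ʳ b , q≢[] , refl
        ; properSuffix = d , d≢[] , eq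
        ; notInternal  = λ { ([] , _ , u≢[] , _) → u≢[] refl
                           ; (_ ∷ u , u′ , _ , u′≢[] , eq′) → internal u u′ u′≢[] (∷-injectiveʳ eq′) }
        } , ≡.sym (++-identityʳ _)
      where
      d≢[] : d ≢ []
      d≢[] refl = q≢[] (++-identityʳ-unique w (≡.sym eq))
      internal : ∀ u u′ → u′ ≢ [] → w′ ++ q′ ∷ʳ b ≡ u ++ w ++ u′ → ⊥
      internal u u′ u′≢[] eq′ with initLast u′
      ... | []       = u′≢[] refl
      ... | v ∷ʳ′ b′ = ¬inner (u , v , ∷ʳ-injectiveˡ (w′ ++ q′) (u ++ w ++ v)
              (≡.trans (++-assoc w′ q′ [ b ]) (≡.trans eq′
                (≡.trans (cong (u ++_) (≡.sym (++-assoc w v [ b′ ]))) (≡.sym (++-assoc u (w ++ v) [ b′ ]))))))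
    firstReturn′ zero _ d le q≢[] p eq | [] ∷ʳ′ b | yes _ = ⊥-elim (≤⇒≯ le (s≤s z≤n))
    firstReturn′ zero _ d le q≢[] p eq | (_ ∷ _) ∷ʳ′ b | yes _ = ⊥-elim (≤⇒≯ le (s≤s z≤n))
    firstReturn′ (suc k) _ d le q≢[] p eq | q′ ∷ʳ′ b | yes (u , v , eq′)
      with prefix-comparable w (c₀ ∷ u ++ w) {q′} {v} (cong (c₀ ∷_) (≡.trans eq′ (≡.sym (++-assoc u w v))))
             (length-++≤ (c₀ ∷ u) w)
    ... | e , uw≡we , refl with firstReturn′ k e (c₀ ∷ u) e≤k e≢[] (prefix-∈ (w ++ e) p′) (≡.sym uw≡we)
      where
      e≤k : length e ≤ k
      e≤k with s≤s le′ ← subst (_≤ suc k) (length-∷ʳ (e ++ v) b) le = ≤-trans (length-≤++ e v) le′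
      e≢[] : e ≢ []
      e≢[] refl with () ← ++-identityˡ-unique (c₀ ∷ u) (≡.sym (≡.trans uw≡we (++-identityʳ w)))
      p′ : (w ++ e) ++ v ∷ʳ b ∈ S
      p′ = subst (_∈ S) (≡.trans (cong (w ++_) (++-assoc e v [ b ])) (≡.sym (++-assoc w e (v ∷ʳ b)))) p
    ... | r , z , cr , refl = r , z ++ v ∷ʳ b , cr ,
          ≡.trans (++-assoc (r ++ z) v [ b ]) (++-assoc r z (v ∷ʳ b))

  -- The first return to `w` cannot pass the marked occurrence, which therefore persists after one
  -- return word is split off.
  firstReturn : ∀ y d g → w ++ y ∈ S → d ≢ [] → w ++ y ≡ d ++ w ++ g →
    ∃₂ λ r z → RightReturn S w r × y ≡ r ++ z × ∃ λ d′ → w ++ z ≡ d′ ++ w ++ g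
  firstReturn y d g p d≢[] eq
    with prefix-comparable w (d ++ w) {y} {g} (≡.trans eq (≡.sym (++-assoc d w g))) (length-++≤ d w)
  ... | e , dw≡we , refl with firstReturn′ (length e) e d ≤-refl e≢[] (prefix-∈ (w ++ e) p′) (≡.sym dw≡we)
    where
    e≢[] : e ≢ []
    e≢[] refl = d≢[] (++-identityˡ-unique d (≡.sym (≡.trans dw≡we (++-identityʳ w))))
    p′ : (w ++ e) ++ g ∈ S
    p′ = subst (_∈ S) (≡.sym (++-assoc w e g)) p
  ... | r , z , cr , refl with IsCompleteReturn.properSuffix cr
  ... | h , _ , wr≡hw = r , z ++ g , cr , ++-assoc r z g
      , suffix-comparable h d (≡.trans (≡.sym
          (≡.trans (cong (w ++_) (++-assoc r z g)) (≡.trans (≡.sym (++-assoc w r (z ++ g)))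
            (≡.trans (cong (_++ z ++ g) wr≡hw) (++-assoc h w (z ++ g)))))) eq)
          (wg≤wzg)
      where
      wg≤wzg : length (w ++ g) ≤ length (w ++ z ++ g)
      wg≤wzg rewrite length-++ w {g} | length-++ w {z ++ g} = +-monoʳ-≤ (length w) (length-++≤ z g)

  Distinct : List (Σ W (RightReturn S w)) → Set _
  Distinct = AllPairs (λ g g′ → proj₁ g ≢ proj₁ g′)

  private
    bit : (gs : List (Σ W (RightReturn S w))) → (Fin (length gs) → Bool) → W → Bool
    bit []       e r = false
    bit (g ∷ gs) e r with List.≡-dec Fin._≟_ (proj₁ g) r
    ... | yes _ = e zero
    ... | no _  = bit gs (e ∘ suc) r

    bit-lookup : ∀ gs → Distinct gs → ∀ e i → bit gs e (proj₁ (lookup gs i)) ≡ e i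
    bit-lookup (g ∷ gs) (≢s ∷ d) e zero with List.≡-dec Fin._≟_ (proj₁ g) (proj₁ g)
    ... | yes _ = refl
    ... | no ≢  = ⊥-elim (≢ refl)
    bit-lookup (g ∷ gs) (≢s ∷ d) e (suc i) with List.≡-dec Fin._≟_ (proj₁ g) (proj₁ (lookup gs i))
    ... | yes eq = ⊥-elim (All.lookup ≢s (∈-lookup i) eq)
    ... | no _   = bit-lookup gs d (e ∘ suc) i

  -- Every function from k distinct return words to ℤ/2 is induced by one of
  -- the 2ⁿ functions on letters.
  distinct-bounded : ∀ gs → Distinct gs → length gs ≤ n
  distinct-bounded gs distinct with n <? length gs
  ... | no n≮    = ≮⇒≥ n≮
  ... | yes n<gs = ⊥-elim (e≢e′ λ i → ≡.trans (≡.sym (induced-lookup e i))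
                    (≡.trans (extend-cong Fe≗Fe′ (proj₁ (lookup gs i))) (induced-lookup e′ i)))
    where
    realized = λ e → realize ℤ/2 (bit gs e ∘ proj₁) (cong (bit gs e)) gs
    F : (Fin (length gs) → Bool) → Fin n → Bool
    F e = proj₁ (realized e)
    induced-lookup : ∀ e i → extend ℤ/2 (F e) (proj₁ (lookup gs i)) ≡ e i
    induced-lookup e i = ≡.trans (proj₂ (realized e) (∈-lookup i)) (bit-lookup gs distinct e i)
    extend-cong : ∀ {f f′ : A → Bool} → f ≗ f′ → ∀ v → extend ℤ/2 f v ≡ extend ℤ/2 f′ v
    extend-cong eq []      = refl
    extend-cong eq (a ∷ v) = cong₂ _xor_ (eq a) (extend-cong eq v)
    collision = pigeonhole-functions n<gs F
    e  = proj₁ collision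
    e′ = proj₁ (proj₂ collision)
    e≢e′ = proj₁ (proj₂ (proj₂ collision))
    Fe≗Fe′ = proj₂ (proj₂ (proj₂ collision))

  -- Taking `w′` in place of `w` excludes the occurrence of `w` that `z` follows.
  ReturnsWithin : ℕ → Set _
  ReturnsWithin m = ∀ z → length z ≡ m → w ++ z ∈ S → Contains w (w′ ++ z)

  private
    -- Recurrence completes a failing `z` of length `m` to a return word longer than `m`, hence new;
    -- `distinct-bounded` limits how often this happens.
    explore : ∀ fuel gs → Distinct gs → n < fuel + length gs →
      ∀ m → All (λ g → length (proj₁ g) ≤ m) gs → ∃ ReturnsWithin
    explore zero gs distinct n< m short = ⊥-elim (≤⇒≯ (distinct-bounded gs distinct) n<)
    explore (suc fuel) gs distinct n< m short
      with searchWords (λ z → member? (w ++ z) ×-dec ¬? (contains? Fin._≟_ w (w′ ++ z))) m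
    ... | inj₂ none = m , λ z len p → case contains? Fin._≟_ w (w′ ++ z) of λ
          { (yes co) → co ; (no ¬co) → ⊥-elim (none z len (p , ¬co)) }
    ... | inj₁ (z , refl , p , ¬co) with recurrence p w∈S
    ... | v , p′ with firstReturn (z ++ v ++ w) (w ++ z ++ v) []
                   (subst (_∈ S) (++-assoc w z (v ++ w)) p′) (λ ())
                   (cong (c₀ ∷_) (≡.trans (cong (w′ ++_) (≡.trans (≡.sym (++-assoc z v w))
                       (cong ((z ++ v) ++_) (≡.sym (++-identityʳ w))))) (≡.sym (++-assoc w′ (z ++ v) (w ++ [])))))
    ... | r , t , cr , eq , _ = explore fuel ((r , cr) ∷ gs)
          (All.map (λ le r≡ → ≤⇒≯ le (subst (λ x → length z < length x) r≡ z<r)) short ∷ distinct)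
          (subst (n <_) (≡.sym (+-suc fuel (length gs))) n<)
          (length r) (≤-refl ∷ All.map (λ le → ≤-trans le (<⇒≤ z<r)) short)
      where
      z<r : length z < length r
      z<r with length z <? length r
      ... | yes lt = lt
      ... | no z≮r with prefix-comparable r z (≡.sym eq) (≮⇒≥ z≮r) | IsCompleteReturn.properSuffix cr
      ... | x , refl , _ | []    , h≢[] , _     = ⊥-elim (h≢[] refl)
      ... | x , refl , _ | _ ∷ h , _    , wr≡hw = ⊥-elim (¬co (h , x ,
            ≡.trans (≡.sym (++-assoc w′ r x)) (≡.trans (cong (_++ x) (∷-injectiveʳ wr≡hw)) (++-assoc h w x))))

  uniformlyRecurrent : ∃ ReturnsWithin
  -- After `suc n` rounds there would be more than `n` distinct return words.
  uniformlyRecurrent = explore (suc n) [] [] (s≤s (m≤m+n n 0)) 0 []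

  private
    -- While more than `m` letters follow an occurrence of `w`, a later occurrence exists, so moving
    -- on to it shortens the rest.
    lastOccurrence : ∀ m → ReturnsWithin m → ∀ k x → length x ≤ k → w ++ x ∈ S →
      ∃₂ λ p g → w ++ x ≡ p ++ w ++ g × length g ≤ m
    lastOccurrence m within k x le p with length x ≤? m
    ... | yes short = [] , x , refl , short
    lastOccurrence m within zero [] le p | no long = ⊥-elim (long z≤n)
    lastOccurrence m within (suc k) x le p | no long
      with within (take m x) take-length (prefix-∈ (w ++ take m x) (subst (_∈ S) w++x p))
      where
      take-length : length (take m x) ≡ m
      take-length = ≡.trans (length-take m x) (m≤n⇒m⊓n≡m (<⇒≤ (≰⇒> long)))
      w++x : w ++ x ≡ (w ++ take m x) ++ drop m x
      w++x = ≡.trans (cong (w ++_) (≡.sym (take++drop≡id m x))) (≡.sym (++-assoc w _ _))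
    ... | u , q , eq =
      let p′ , g , eq′ , short = lastOccurrence m within k (q ++ drop m x) shorter
            (suffix-∈ (c₀ ∷ u) (subst (_∈ S) w++x p))
      in c₀ ∷ u ++ p′ , g
         , ≡.trans w++x (≡.trans (cong (λ y → c₀ ∷ u ++ y) eq′) (cong (c₀ ∷_) (≡.sym (++-assoc u p′ (w ++ g)))))
         , short
      where
      w++x : w ++ x ≡ (c₀ ∷ u) ++ w ++ q ++ drop m x
      w++x = cong (c₀ ∷_) (begin
        w′ ++ x                          ≡⟨ cong (w′ ++_) (take++drop≡id m x) ⟨
        w′ ++ take m x ++ drop m x       ≡⟨ ++-assoc w′ _ _ ⟨
        (w′ ++ take m x) ++ drop m x     ≡⟨ cong (_++ drop m x) eq ⟩
        (u ++ w ++ q) ++ drop m x        ≡⟨ ++-assoc u _ _ ⟩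
        u ++ (w ++ q) ++ drop m x        ≡⟨ cong (u ++_) (++-assoc w q _) ⟩
        u ++ w ++ q ++ drop m x          ∎)
        where open ≡.≡-Reasoning
      shorter : length (q ++ drop m x) ≤ k
      shorter = +-cancelˡ-≤ (length w) _ _ (begin
        length w + length (q ++ drop m x)       ≡⟨ length-++ w ⟨
        length (w ++ q ++ drop m x)             ≤⟨ length-++≤ u _ ⟩
        length (u ++ w ++ q ++ drop m x)        ≡⟨ cong length (∷-injectiveʳ w++x) ⟨
        length (w′ ++ x)                        ≡⟨ length-++ w′ ⟩
        length w′ + length x                    ≤⟨ +-monoʳ-≤ (length w′) le ⟩
        length w′ + suc k                       ≡⟨ +-suc (length w′) k ⟩
        length w + k                            ∎)
        where open ≤-Reasoning

  -- In a word `w ++ v ++ y` of `S` some occurrence of `w` has at most `m` letters after it; it lies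
  -- inside `y` once `y` has length at least `length w + m`.
  long-contains : ∃ λ k → ∀ y → y ∈ S → k ≤ length y → Contains w y
  long-contains =
    let m , within = uniformlyRecurrent in length w + m , λ y y∈S long →
    let v , p = recurrence w∈S y∈S
        p′ , g , eq , short = lastOccurrence m within _ (v ++ y) ≤-refl p
        e , y≡ = suffix-comparable (w ++ v) p′ (≡.trans (++-assoc w v y) eq)
          (≤-trans (≤-reflexive (length-++ w)) (≤-trans (+-monoʳ-≤ (length w) short) long))
    in e , g , y≡

-- Parity and the exchange of two states.

opposite-≢ : ∀ (i : Fin 2) → opposite i ≢ i
opposite-≢ zero       ()
opposite-≢ (suc zero) ()

≢⇒opposite : ∀ {i j : Fin 2} → i ≢ j → i ≡ opposite j
≢⇒opposite {zero}     {zero}     i≢j = ⊥-elim (i≢j refl)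
≢⇒opposite {zero}     {suc zero} i≢j = refl
≢⇒opposite {suc zero} {zero}     i≢j = refl
≢⇒opposite {suc zero} {suc zero} i≢j = ⊥-elim (i≢j refl)

opposite^ : ℕ → Fin 2 → Fin 2
opposite^ zero    i = i
opposite^ (suc k) i = opposite^ k (opposite i)

2∣⇒opposite^ : ∀ {k} → 2 ∣ k → ∀ i → opposite^ k i ≡ i
2∣⇒opposite^ (divides zero    refl) i = refl
2∣⇒opposite^ (divides (suc q) refl) i =
  ≡.trans (2∣⇒opposite^ (divides q refl) _) (Fin.opposite-involutive i)

opposite^⇒2∣ : ∀ k i → opposite^ k i ≡ i → 2 ∣ k
opposite^⇒2∣ zero          i eq = 2 ∣0
opposite^⇒2∣ (suc zero)    i eq = ⊥-elim (opposite-≢ i eq)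
opposite^⇒2∣ (suc (suc k)) i eq = ∣m∣n⇒∣m+n ∣-refl
  (opposite^⇒2∣ k i (≡.trans (cong (opposite^ k) (≡.sym (Fin.opposite-involutive i))) eq))

xor-exchange : ∀ p q r s → p xor q ≡ not (r xor s) → p xor s ≡ not (r xor q)
xor-exchange true  q true  s eq = ≡.trans (≡.sym (not-injective eq)) (≡.sym (not-involutive q))
xor-exchange true  q false s eq = ≡.sym eq
xor-exchange false q true  s eq = ≡.sym (≡.trans (cong (not ∘ not) (≡.trans eq (not-involutive s))) (not-involutive s))
xor-exchange false q false s eq = ≡.trans (≡.sym (not-involutive s)) (cong not (≡.sym eq))

-- Specular sets and the automaton of the two trees.

module Specular {ℓ : Level} {n : ℕ} (θ : Fin n → Fin n) (θ-inv : Involutive _≡_ θ)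
  (S : Pred (List (Fin n)) ℓ) (spec : IsSpecular θ θ-inv S) ([]∈S : [] ∈ S) where

  private
    A = Fin n
    W = List A

  open IsSpecular spec
  open IsLaminary isLaminary
  open IsBiextendable isBiextendable
  open IsFactorial isFactorial
  open IsTreeSet isTreeSet using (treeOfNonempty; treesOfEmpty)
  open IsDisjointUnionOfTrees treesOfEmpty using (treeOf; adj⇒same)
  open InvolutiveGroup (≡.setoid A) θ (cong θ) θ-inv using (_∼_; nil; cons; cancel; sym; trans)

  forest : ∀ {y} → y ∈ S → IsForest (extensionGraph S y)
  forest {[]}    _ = trees⇒forest treesOfEmpty
  forest {_ ∷ _} p = tree⇒forest (treeOfNonempty (λ ()) p)

  open Extensions S isFactorial []∈S forest

  vertex : ∀ u → LRVertex S [] u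
  vertex (inj₁ a) = left (letters a)
  vertex (inj₂ b) = right (letters b)

  connected-tree : ∀ {u v} → treeOf u ≡ treeOf v → Star (Edge S []) u v
  connected-tree = IsForest.connected (forest {[]} []∈S) (vertex _) (vertex _)

  -- A letter is an arrow from the tree of its occurrence in R(ε) to the tree of its occurrence in
  -- L(ε), so that in a word ab of `S` the arrow b starts where a ends.
  source target : A → Fin 2
  source a = treeOf (inj₂ a)
  target a = treeOf (inj₁ a)

  -- The reversal a ↦ θ(a) exchanges the sides of the extension graph of the
  -- empty word.  The label [a < θ(b)] takes each value once on every pair of
  -- edges (a , b), (θ(b) , θ(a)); so were a joined to θ(a), the potential
  -- splitting it would change sign along a walk of odd length and come back.
  target≢source-θ : ∀ a → target a ≢ source (θ a)
  target≢source-θ a same = not-¬ (invariant-walk (connected-tree same))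
    (≡.trans (cong (λ x → α x xor β (θ a)) (≡.sym (θ-inv a))) (≡.sym (not-involutive _)))
    where
    lab : A → A → Bool
    lab a b = does (a Fin.<? θ b)

    split = splitLabel ℤ/2 [] lab
    α = proj₁ split
    β = proj₁ (proj₂ split)

    -- The potentials of a vertex and of its mirror image under `θ` are added; the negation on the
    -- right side makes the sum constant along edges.
    invariant : A ⊎ A → Bool
    invariant (inj₁ a) = α a xor β (θ a)
    invariant (inj₂ b) = not (α (θ b) xor β b)

    <?-antisym : ∀ {a b : A} → a ≢ b → does (a Fin.<? b) ≡ not (does (b Fin.<? a))
    <?-antisym {a} {b} a≢b with Fin.<-cmp a b
    ... | tri< a<b _ b≮a = ≡.trans (dec-true (a Fin.<? b) a<b) (cong not (≡.sym (dec-false (b Fin.<? a) b≮a)))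
    ... | tri≈ _ eq _    = ⊥-elim (a≢b eq)
    ... | tri> a≮b _ b<a = ≡.trans (dec-false (a Fin.<? b) a≮b) (cong not (≡.sym (dec-true (b Fin.<? a) b<a)))

    invariant-edge : ∀ {a b} → a ∷ b ∷ [] ∈ S → invariant (inj₁ a) ≡ invariant (inj₂ b)
    invariant-edge {a} {b} p = xor-exchange (α a) (β b) (α (θ b)) (β (θ a)) (begin
      α a xor β b                     ≡⟨ proj₂ (proj₂ split) a b p ⟨
      does (a Fin.<? θ b)             ≡⟨ <?-antisym a≢θb ⟩
      not (does (θ b Fin.<? a))       ≡⟨ cong (λ x → not (does (θ b Fin.<? x))) (θ-inv a) ⟨
      not (does (θ b Fin.<? θ (θ a))) ≡⟨ cong not (proj₂ (proj₂ split) (θ b) (θ a) (inverse-closed p)) ⟩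
      not (α (θ b) xor β (θ a))       ∎)
      where
      open ≡.≡-Reasoning
      a≢θb : a ≢ θ b
      -- If `a` were `θ b`, the edge would be its own mirror image, but then the word would not be
      -- reduced.
      a≢θb refl = reduced p ([] , [] , θ b , cong (λ x → θ b ∷ x ∷ []) (≡.sym (θ-inv b)))

    invariant-walk : ∀ {u v} → Star (Edge S []) u v → invariant u ≡ invariant v
    invariant-walk ε             = refl
    invariant-walk (edge p ◅ s)  = ≡.trans (invariant-edge p) (invariant-walk s)
    invariant-walk (edge⁻ p ◅ s) = ≡.trans (≡.sym (invariant-edge p)) (invariant-walk s)

  source-θ : ∀ a → source (θ a) ≡ opposite (target a)
  source-θ a = ≢⇒opposite (target≢source-θ a ∘ ≡.sym)

  target-θ : ∀ a → target (θ a) ≡ opposite (source a)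
  target-θ a = ≢⇒opposite (subst (λ x → target (θ a) ≢ source x) (θ-inv a) (target≢source-θ (θ a)))

  private
    even? = evenLetter? θ θ-inv spec

  step : Fin 2 → A → Fin 2
  step i a with even? a
  ... | yes _ = i
  ... | no _  = opposite i

  step-opposite : ∀ i a → step (opposite i) a ≡ opposite (step i a)
  step-opposite i a with even? a
  ... | yes _ = refl
  ... | no _  = refl

  step-source : ∀ a → step (source a) a ≡ target a
  step-source a with even? a
  ... | yes even = ≡.sym even
  ... | no odd   = ≡.sym (≢⇒opposite odd)

  -- Away from its source, `a` runs backwards along the arrow `θ a`, whose target is `i`.
  step-≢source : ∀ {i} a → source a ≢ i → step i a ≡ source (θ a)
  step-≢source {i} a ≢ = begin
    step i a                       ≡⟨ cong (λ j → step j a) (≢⇒opposite (≢ ∘ ≡.sym)) ⟩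
    step (opposite (source a)) a   ≡⟨ step-opposite (source a) a ⟩
    opposite (step (source a) a)   ≡⟨ cong opposite (step-source a) ⟩
    opposite (target a)            ≡⟨ source-θ a ⟨
    source (θ a)                   ∎
    where open ≡.≡-Reasoning

  step-θ : ∀ i a → step (step i a) (θ a) ≡ i
  step-θ i a with source a Fin.≟ i
  ... | no ≢     = begin
    step (step i a) (θ a)             ≡⟨ cong (λ j → step j (θ a)) (step-≢source a ≢) ⟩
    step (source (θ a)) (θ a)         ≡⟨ step-source (θ a) ⟩
    target (θ a)                      ≡⟨ target-θ a ⟩
    opposite (source a)               ≡⟨ ≢⇒opposite (≢ ∘ ≡.sym) ⟨
    i                                 ∎
    where open ≡.≡-Reasoning
  ... | yes refl = begin
    step (step (source a) a) (θ a)    ≡⟨ cong (λ j → step j (θ a)) (step-source a) ⟩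
    step (target a) (θ a)             ≡⟨ step-≢source (θ a) (target≢source-θ a ∘ ≡.sym) ⟩
    source (θ (θ a))                  ≡⟨ cong source (θ-inv a) ⟩
    source a                          ∎
    where open ≡.≡-Reasoning

  state : Fin 2 → W → Fin 2
  state = foldl step

  state-cong : ∀ i {u v} → u ∼ v → state i u ≡ state i v
  state-cong i nil           = refl
  state-cong i (cons refl p) = state-cong _ p
  state-cong i (cancel a u)  = cong (λ j → state j u) (step-θ i a)
  state-cong i (sym p)       = ≡.sym (state-cong i p)
  state-cong i (trans p q)   = ≡.trans (state-cong i p) (state-cong i q)

  state-odd : ∀ i v → state i v ≡ opposite^ (length (filter (λ a → ¬? (even? a)) v)) i
  state-odd i []      = refl
  state-odd i (a ∷ v) with even? a
  ... | yes _ = state-odd i v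
  ... | no _  = state-odd (opposite i) v

  even⇒state : ∀ v i → EvenWord θ θ-inv spec v → state i v ≡ i
  even⇒state v i even = ≡.trans (state-odd i v) (2∣⇒opposite^ even i)

  state⇒even : ∀ v i → state i v ≡ i → EvenWord θ θ-inv spec v
  state⇒even v i eq = opposite^⇒2∣ _ i (≡.trans (≡.sym (state-odd i v)) eq)

  target-source : ∀ {a b} → a ∷ b ∷ [] ∈ S → target a ≡ source b
  target-source p = adj⇒same (edge p)

  -- Words of S are paths from tree to tree.
  state-path : ∀ a v b → a ∷ v ∷ʳ b ∈ S → state (source a) (a ∷ v) ≡ source b
  state-path a []      b p = ≡.trans (step-source a) (target-source p)
  state-path a (c ∷ v) b p =
    ≡.trans (cong (λ i → state i (c ∷ v))
              (≡.trans (step-source a) (target-source (prefix-∈ (a ∷ c ∷ []) p))))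
      (state-path c v b (suffix-∈ [ a ] p))

  module Development {c ℓ′ : Level} (H : Group c ℓ′) (f : A → Group.Carrier H) where

    open Group H using (Carrier; _≈_; _∙_; _⁻¹; assoc; ∙-cong; ∙-congˡ; ∙-congʳ; inverseˡ; inverseʳ; identityˡ)
      renaming (ε to 1#; refl to ≈-refl; sym to ≈-sym; trans to ≈-trans; reflexive to ≈-reflexive)

    -- The map `f` need not send `a` and `θ a` to inverse elements. Away from its source, `a` counts
    -- as the arrow `θ a` run backwards, so the relations of the group hold once the state is
    -- tracked.
    develop-letter : Fin 2 → A → Carrier
    develop-letter i a with source a Fin.≟ i
    ... | yes _ = f a
    ... | no _  = f (θ a) ⁻¹

    develop : Fin 2 → W → Carrier
    develop i []      = 1#
    develop i (a ∷ v) = develop-letter i a ∙ develop (step i a) v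

    develop-source : ∀ a → develop-letter (source a) a ≡ f a
    develop-source a with source a Fin.≟ source a
    ... | yes _ = refl
    ... | no ≢  = ⊥-elim (≢ refl)

    develop-≢source : ∀ {i} a → source a ≢ i → develop-letter i a ≡ f (θ a) ⁻¹
    develop-≢source {i} a ≢ with source a Fin.≟ i
    ... | yes eq = ⊥-elim (≢ eq)
    ... | no _   = refl

    develop-θ : ∀ i a → develop-letter i a ∙ develop-letter (step i a) (θ a) ≈ 1#
    develop-θ i a with source a Fin.≟ i
    ... | yes refl = ≈-trans (∙-congˡ (≈-reflexive (≡.trans
            (develop-≢source (θ a) (λ eq → target≢source-θ a (≡.sym (≡.trans eq (step-source a)))))
            (cong (λ x → f x ⁻¹) (θ-inv a))))) (inverseʳ _)
    ... | no ≢ = ≈-trans (∙-congˡ (≈-reflexive (≡.trans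
            (cong (λ j → develop-letter j (θ a)) (step-≢source a ≢)) (develop-source (θ a))))) (inverseˡ _)

    develop-cong : ∀ i {u v} → u ∼ v → develop i u ≈ develop i v
    develop-cong i nil           = ≈-refl
    develop-cong i (cons refl p) = ∙-congˡ (develop-cong _ p)
    develop-cong i (cancel a u)  = ≈-trans (≈-sym (assoc _ _ _)) (≈-trans (∙-congʳ (develop-θ i a))
      (≈-trans (identityˡ _) (≈-reflexive (cong (λ j → develop j u) (step-θ i a)))))
    develop-cong i (sym p)       = ≈-sym (develop-cong i p)
    develop-cong i (trans p q)   = ≈-trans (develop-cong i p) (develop-cong i q)

    develop-++ : ∀ i u v → develop i (u ++ v) ≈ develop i u ∙ develop (state i u) v
    develop-++ i []      v = ≈-sym (identityˡ _)
    develop-++ i (a ∷ u) v = ≈-trans (∙-congˡ (develop-++ (step i a) u v)) (≈-sym (assoc _ _ _))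

    -- A word of `S` meets each of its letters at the source of that letter, so no inverses arise.
    develop-path : ∀ a v → a ∷ v ∈ S → develop (source a) (a ∷ v) ≈ extend H f (a ∷ v)
    develop-path a [] p = ∙-congʳ (≈-reflexive (develop-source a))
    develop-path a (b ∷ v) p = ∙-cong (≈-reflexive (develop-source a))
      (≈-trans (≈-reflexive (cong (λ i → develop i (b ∷ v))
                 (≡.trans (step-source a) (target-source (prefix-∈ (a ∷ b ∷ []) p)))))
        (develop-path b v (suffix-∈ [ a ] p)))

-- Evaluation and cosets of a generated subgroup.

module Generators {c ℓ p : Level} (G : Group c ℓ) (X : Pred (Group.Carrier G) p) where

  open Group G hiding (inverse) renaming (refl to ≈-refl)
  open FreeGroup (subsetSetoid G X) using (_∼_; nil; cons; cancel; inverse)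
    renaming (sym to ∼-sym; trans to ∼-trans; inverseˡ to inverseˡᶠ)
  open GroupProperties G using (inverseˡ-unique; \\-leftDividesʳ)

  eval-++ : ∀ u v → eval G X (u ++ v) ≈ eval G X u ∙ eval G X v
  eval-++ []           v = sym (identityˡ _)
  eval-++ (inj₁ _ ∷ u) v = trans (∙-congˡ (eval-++ u v)) (sym (assoc _ _ _))
  eval-++ (inj₂ _ ∷ u) v = trans (∙-congˡ (eval-++ u v)) (sym (assoc _ _ _))

  eval-cong : ∀ {u v} → u ∼ v → eval G X u ≈ eval G X v
  eval-cong nil                     = ≈-refl
  eval-cong (cons (⊎.inj₁ x≈y) p)   = ∙-cong x≈y (eval-cong p)
  eval-cong (cons (⊎.inj₂ x≈y) p)   = ∙-cong (⁻¹-cong x≈y) (eval-cong p)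
  eval-cong (cancel (inj₁ x) u)     = trans (sym (assoc _ _ _)) (trans (∙-congʳ (inverseʳ _)) (identityˡ _))
  eval-cong (cancel (inj₂ x) u)     = trans (sym (assoc _ _ _)) (trans (∙-congʳ (inverseˡ _)) (identityˡ _))
  eval-cong (∼-sym p)               = sym (eval-cong p)
  eval-cong (∼-trans p q)           = trans (eval-cong p) (eval-cong q)

  eval-inverse : ∀ u → eval G X (inverse u) ≈ eval G X u ⁻¹
  eval-inverse u = inverseˡ-unique _ _ (trans (sym (eval-++ (inverse u) u)) (eval-cong (inverseˡᶠ u)))

  infix 4 _≋_

  -- Equality of right cosets of the subgroup generated by X.
  _≋_ : Carrier → Carrier → Set _
  g ≋ h = ∃[ u ] eval G X u ∙ h ≈ g

  ≈⇒≋ : ∀ {g h} → g ≈ h → g ≋ h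
  ≈⇒≋ g≈h = [] , trans (identityˡ _) (sym g≈h)

  ≋-sym : ∀ {g h} → g ≋ h → h ≋ g
  ≋-sym {g} {h} (u , eq) = inverse u , (begin
    eval G X (inverse u) ∙ g                       ≈⟨ ∙-cong (eval-inverse u) (sym eq) ⟩
    eval G X u ⁻¹ ∙ (eval G X u ∙ h)               ≈⟨ \\-leftDividesʳ _ _ ⟩
    h                                              ∎)
    where
    open SetoidReasoning setoid

  ≋-trans : ∀ {g h k} → g ≋ h → h ≋ k → g ≋ k
  ≋-trans (u , p) (v , q) = u ++ v ,
    trans (∙-congʳ (eval-++ u v)) (trans (assoc _ _ _) (trans (∙-congˡ q) p))

  ≋-congʳ : ∀ {g h} k → g ≋ h → g ∙ k ≋ h ∙ k
  ≋-congʳ k (u , p) = u , trans (sym (assoc _ _ _)) (∙-congʳ p)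

  generator-≋ : ∀ {x} → X x → ∀ g → x ∙ g ≋ g
  generator-≋ {x} p g = inj₁ (x , p) ∷ [] , ∙-congʳ (identityʳ x)

-- Generation of the even subgroup by the return words.

module Basis {ℓ : Level} {n : ℕ} (θ : Fin n → Fin n) (θ-inv : Involutive _≡_ θ)
  (S : Pred (List (Fin n)) ℓ) (spec : IsSpecular θ θ-inv S) (isRecurrent : IsRecurrent S)
  (c₀ : Fin n) (w′ : List (Fin n)) (w∈S : c₀ ∷ w′ ∈ S) where

  private
    A = Fin n
    W = List A
    w : W
    w = c₀ ∷ w′
    G = Gθ θ θ-inv
    X = RightReturn S w
    []∈S : [] ∈ S
    []∈S = IsFactorial.factors (IsRecurrent.isFactorial isRecurrent) [] [] w w∈S

  open IsRecurrent isRecurrent using (recurrence)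
  open IsSpecular spec
  open IsLaminary isLaminary using (isBiextendable)
  open IsBiextendable isBiextendable
  open IsFactorial isFactorial using (letters)
  open IsTreeSet isTreeSet using (treeOfNonempty; treesOfEmpty)
  open IsDisjointUnionOfTrees treesOfEmpty using (treeOf)
  open InvolutiveGroup (≡.setoid A) θ (cong θ) θ-inv
  open Specular θ θ-inv S spec []∈S
  open Extensions S isFactorial []∈S forest using (prefix-∈; suffix-∈)
  open Returns S isRecurrent forest c₀ w′ w∈S using (firstReturn; long-contains)
  open Realization S isFactorial []∈S forest c₀ w′ using (return≢[]; realize)
  open Generators G X

  ≡⇒≋ : ∀ {g h} → g ≡ h → g ≋ h
  ≡⇒≋ eq = ≈⇒≋ (∼-reflexive eq)

  private
    -- As long as `d` is nonempty, `g` begins with a return word, which is removed as a generator on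
    -- the left.
    return-≋′ : ∀ k g d g₀ → length g ≤ k → w ++ g ∈ S → w ++ g ≡ d ++ w ++ g₀ → g ≋ g₀
    return-≋′ k g [] g₀ le p eq = ≡⇒≋ (++-cancelˡ w g g₀ eq)
    return-≋′ k g d@(_ ∷ _) g₀ le p eq with firstReturn g d g₀ p (λ ()) eq
    ... | [] , z , cr , _ , _ = ⊥-elim (return≢[] cr refl)
    return-≋′ (suc k) _ (_ ∷ _) g₀ (s≤s le) p eq | b ∷ r , z , cr , refl , d′ , eq′ =
      ≋-trans (generator-≋ cr z) (return-≋′ k z d′ g₀
        (≤-trans (length-++≤ r z) le)
        wz∈S eq′)
      where
      wz∈S : w ++ z ∈ S
      wz∈S with IsCompleteReturn.properSuffix cr
      ... | h , _ , eq″ = suffix-∈ h (subst (_∈ S)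
              (≡.trans (≡.sym (++-assoc w (b ∷ r) z)) (≡.trans (cong (_++ z) eq″) (++-assoc h w z))) p)

  occurrences-≋ : ∀ {x} p g p₀ g₀ → x ∈ S → x ≡ p ++ w ++ g → x ≡ p₀ ++ w ++ g₀ → g ≋ g₀
  occurrences-≋ p g p₀ g₀ x∈S refl eq with ≤-total (length (w ++ g₀)) (length (w ++ g))
  ... | inj₁ le = let e , wg≡ = suffix-comparable p p₀ eq le in
        return-≋′ _ g e g₀ ≤-refl (suffix-∈ p x∈S) wg≡
  ... | inj₂ le = let e , wg₀≡ = suffix-comparable p₀ p (≡.sym eq) le in
        ≋-sym (return-≋′ _ g₀ e g ≤-refl (suffix-∈ p₀ (subst (_∈ S) eq x∈S)) wg₀≡)

  -- g is read from some occurrence of w to the end of y, within a word of S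
  -- ending with y.
  data Since (y g : W) : Set ℓ where
    since : ∀ h p → h ++ y ∈ S → h ++ y ≡ p ++ w ++ g → Since y g

  since-∈ : ∀ {y g} → Since y g → y ∈ S
  since-∈ (since h _ hy∈S _) = suffix-∈ h hy∈S

  since-exists : ∀ {y} → y ∈ S → ∃ (Since y)
  since-exists {y} y∈S =
    let v , p = recurrence w∈S y∈S in
    v ++ y , since (w ++ v) [] (subst (_∈ S) (≡.sym (++-assoc w v y)) p) (++-assoc w v y)

  since-extend : ∀ {y g} → Since y g → ∃ λ a → Since (a ∷ y) g
  since-extend {y} (since h p hy∈S eq) with initLast h
  ... | [] = let (a , b) , q = extendable hy∈S in
             a , since [] (a ∷ p) (prefix-∈ (a ∷ y) q) (cong (a ∷_) eq)
  ... | h′ ∷ʳ′ a = a , since h′ p (subst (_∈ S) (++-assoc h′ [ a ] y) hy∈S)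
                            (≡.trans (≡.sym (++-assoc h′ [ a ] y)) eq)

  -- The same occurrence of `a ∷ y ∷ʳ b` after `w` is read up to `y` and up to `b`, so the two
  -- readings differ by exactly `b`.
  since-edge : ∀ {a y b} → a ∷ y ∷ʳ b ∈ S → ∃ λ g → Since (a ∷ y) g × Since (y ∷ʳ b) (g ∷ʳ b)
  since-edge {a} {y} {b} p =
    let v , q = recurrence w∈S p in
    v ++ a ∷ y
    , since (w ++ v) [] (prefix-∈ ((w ++ v) ++ a ∷ y) (subst (_∈ S) (eq₁ v) q)) (++-assoc w v (a ∷ y))
    , since (w ++ v ∷ʳ a) [] (subst (_∈ S) (eq₂ v) q)
        (≡.trans (≡.sym (eq₂ v)) (cong (w ++_) (≡.sym (++-assoc v (a ∷ y) [ b ]))))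
    where
    eq₁ : ∀ v → w ++ v ++ a ∷ y ∷ʳ b ≡ ((w ++ v) ++ a ∷ y) ++ [ b ]
    eq₁ v = ≡.trans (≡.sym (++-assoc w v _)) (≡.sym (++-assoc (w ++ v) (a ∷ y) [ b ]))
    eq₂ : ∀ v → w ++ v ++ a ∷ y ∷ʳ b ≡ (w ++ v ∷ʳ a) ++ y ∷ʳ b
    eq₂ v = ≡.trans (cong (w ++_) (≡.sym (++-assoc v [ a ] (y ∷ʳ b)))) (≡.sym (++-assoc w (v ∷ʳ a) (y ∷ʳ b)))

  Coherent : W → Set ℓ
  Coherent y = ∀ {g g′} → Since y g → Since y g′ → g ≋ g′

  cancelʳ-∼ : ∀ g b → (g ∷ʳ b) ∷ʳ θ b ∼ g
  cancelʳ-∼ g b = trans (∼-reflexive (++-assoc g [ b ] [ θ b ]))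
    (trans (++-congˡ g (cancel b [])) (∼-reflexive (++-identityʳ g)))

  cancelʳ-θ-∼ : ∀ g b → (g ∷ʳ θ b) ∷ʳ b ∼ g
  cancelʳ-θ-∼ g b = trans (++-congˡ (g ∷ʳ θ b) (cons (≡.sym (θ-inv b)) nil)) (cancelʳ-∼ g (θ b))

  -- What is read up to y, passing through the given vertex of the extension
  -- graph of y.
  data Through (y : W) : A ⊎ A → W → Set ℓ where
    from : ∀ {a g} → Since (a ∷ y) g → Through y (inj₁ a) g
    to   : ∀ {b g} → Since (y ∷ʳ b) g → Through y (inj₂ b) (g ∷ʳ θ b)

  through-exists : ∀ {y u} → LRVertex S y u → ∃ (Through y u)
  through-exists (left p)  = let g , s = since-exists p in g , from s
  through-exists (right p) = let g , s = since-exists p in _ , to s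

  module _ {y : W} (coherent : ∀ {x} → x ∈ S → length x ≡ suc (length y) → Coherent x) where

    coherent-vertex : ∀ {u g g′} → Through y u g → Through y u g′ → g ≋ g′
    coherent-vertex (from s) (from s′) = coherent (since-∈ s) refl s s′
    coherent-vertex (to {b} s) (to s′) =
      ≋-congʳ [ θ b ] (coherent (since-∈ s) (length-∷ʳ y b) s s′)

    coherent-edge : ∀ {a b g g′} → a ∷ y ∷ʳ b ∈ S →
      Through y (inj₁ a) g → Through y (inj₂ b) g′ → g ≋ g′
    coherent-edge {b = b} p t t′ =
      let g₀ , s , s′ = since-edge p in
      ≋-trans (coherent-vertex t (from s))
        (≋-trans (≋-sym (≈⇒≋ (cancelʳ-∼ g₀ b))) (coherent-vertex (to s′) t′))

    coherent-walk : ∀ {u v g g′} → Star (Edge S y) u v → Through y u g → Through y v g′ → g ≋ g′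
    coherent-walk ε t t′ = coherent-vertex t t′
    coherent-walk (edge p ◅ s) t t′ =
      let _ , t″ = through-exists (right (suffix-∈ [ _ ] p)) in
      ≋-trans (coherent-edge p t t″) (coherent-walk s t″ t′)
    coherent-walk (edge⁻ p ◅ s) t t′ =
      let _ , t″ = through-exists (left (prefix-∈ (_ ∷ y) p)) in
      ≋-trans (≋-sym (coherent-edge p t″ t)) (coherent-walk s t″ t′)

    -- Every reading up to `y` passes through a left vertex, and the extension graph of a nonempty
    -- word is connected.
    coherent-step : y ≢ [] → Coherent y
    coherent-step y≢[] s s′ =
      let _ , t  = since-extend s
          _ , t′ = since-extend s′
      in coherent-walk (IsTree.connected (treeOfNonempty y≢[] (since-∈ s)) (left (since-∈ t)) (left (since-∈ t′)))
           (from t) (from t′)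

  -- Downward induction on length, where `d` bounds how far `y` falls short of `long`. In the base
  -- case `y` contains `w`, and both readings are compared with the one from that occurrence.
  coherent-nonempty : ∀ {y} → y ∈ S → y ≢ [] → Coherent y
  coherent-nonempty {y} y∈S = go long y∈S (m≤n+m long (length y))
    where
    long = proj₁ long-contains
    go : ∀ d {y} → y ∈ S → long ≤ length y + d → y ≢ [] → Coherent y
    go zero {y} y∈S le _ (since h p hy∈S eq) (since h′ p′ hy∈S′ eq′) =
      let p₀ , g₀ , y≡ = proj₂ long-contains y y∈S (subst (long ≤_) (+-identityʳ _) le)
          at = λ h → ≡.trans (cong (h ++_) y≡) (≡.sym (++-assoc h p₀ (w ++ g₀)))
      in ≋-trans (occurrences-≋ p _ (h ++ p₀) g₀ hy∈S eq (at h))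
           (≋-sym (occurrences-≋ p′ _ (h′ ++ p₀) g₀ hy∈S′ eq′ (at h′)))
    go (suc d) {y} y∈S le = coherent-step λ {x} x∈S len →
      go d x∈S (≤-trans le (≤-reflexive (≡.trans (+-suc _ d) (cong (_+ d) (≡.sym len)))))
        (λ { refl → case len of λ () })

  -- What is read up to a tree of the extension graph of the empty word.
  Reaching : Fin 2 → W → Set ℓ
  Reaching i g = ∃ λ u → treeOf u ≡ i × Through [] u g

  -- The extension graph of the empty word has two trees, so walks compare readings only within each
  -- of them.
  coherent-reaching : ∀ {i g g′} → Reaching i g → Reaching i g′ → g ≋ g′
  coherent-reaching (u , eq , t) (v , eq′ , t′) =
    coherent-walk (λ x∈S len → coherent-nonempty x∈S (λ { refl → case len of λ () }))
      (connected-tree (≡.trans eq (≡.sym eq′))) t t′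

  reaching-exists : ∀ b → ∃ (Reaching (source b))
  reaching-exists b = let g , t = through-exists (vertex (inj₂ b)) in g , inj₂ b , refl , t

  -- One reading `g′` up to the letter `b` reaches `target b`; followed by `θ b`, it reaches
  -- `source b`.
  reaching-source : ∀ {b g} → Reaching (source b) g → ∃ λ g′ → Reaching (target b) g′ × g ∷ʳ b ≋ g′
  reaching-source {b} r =
    let g′ , s = since-exists (letters b) in
    g′ , (inj₁ b , refl , from s) ,
    ≋-trans (≋-congʳ [ b ] (coherent-reaching r (inj₂ b , refl , to s))) (≈⇒≋ (cancelʳ-θ-∼ g′ b))

  reaching-step : ∀ {i g} b → Reaching i g → ∃ λ g′ → Reaching (step i b) g′ × g ∷ʳ b ≋ g′
  reaching-step {i} b r with source b Fin.≟ i
  ... | yes refl = subst (λ j → ∃ λ g′ → Reaching j g′ × _ ≋ g′) (≡.sym (step-source b)) (reaching-source r)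
  -- In this state `b` runs backwards along the arrow `θ b`, so the forward case for `θ b` is
  -- inverted.
  ... | no ≢ =
    let g′ , r′ = reaching-exists (θ b)
        g″ , r″ , eq = reaching-source r′
        r‴ = subst (λ j → Reaching j g″) (≡.trans (target-θ b) (≡.sym (≢⇒opposite (≢ ∘ ≡.sym)))) r″
    in g′ , subst (λ j → Reaching j g′) (≡.sym (step-≢source b ≢)) r′
       , ≋-trans (≋-congʳ [ b ] (≋-trans (coherent-reaching r r‴) (≋-sym eq))) (≈⇒≋ (cancelʳ-θ-∼ g′ b))

  reaching-state : ∀ {i g} v → Reaching i g → ∃ λ g′ → Reaching (state i v) g′ × g ++ v ≋ g′
  reaching-state {g = g} []      r = g , r , ≡⇒≋ (++-identityʳ g)
  reaching-state {g = g} (b ∷ v) r =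
    let g′ , r′ , eq = reaching-step b r
        g″ , r″ , eq′ = reaching-state v r′
    in g″ , r″ , ≋-trans (≡⇒≋ (≡.sym (++-assoc g [ b ] v))) (≋-trans (≋-congʳ v eq) eq′)

  -- The tree at which a reading that starts right after `w` begins; the return words lead from it
  -- to itself.
  i₀ : Fin 2
  i₀ = state (source c₀) w

  -- Right after `w` the reading is empty; expressed through the right vertex `b`, it becomes `b`
  -- followed by `θ b`.
  reaching-base : ∃ λ g → Reaching i₀ g × g ∼ []
  reaching-base =
    let (_ , b) , p = extendable w∈S
        wb∈S = suffix-∈ [ _ ] p
    in [ b ] ∷ʳ θ b , (inj₂ b , ≡.sym (state-path c₀ w′ b wb∈S) , to (since w [] wb∈S refl)) , cancel b []

  -- The cosets of `v` and of the empty word both contain readings that reach `i₀`, and coherence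
  -- there identifies them.
  even-generated : ∀ v → state i₀ v ≡ i₀ → v ≋ []
  even-generated v eq =
    let g , r , g∼[] = reaching-base
        g′ , r′ , eq′ = reaching-state v r
    in ≋-trans (≈⇒≋ (sym (++-congʳ v g∼[])))
         (≋-trans eq′ (≋-trans (coherent-reaching (subst (λ i → Reaching i g′) eq r′) r) (≈⇒≋ g∼[])))

  -- Write `w ++ r` as a word u followed by `w`. In `S` the path u starts with `c₀` and is followed
  -- by `c₀`, so it returns to `source c₀`, and reading `w` then ends at `i₀` again.
  state-return : ∀ {r} → X r → state i₀ r ≡ i₀
  state-return {r} cr with IsCompleteReturn.properSuffix cr
  ... | []    , h≢[] , _  = ⊥-elim (h≢[] refl)
  ... | _ ∷ h , _    , eq with refl ← ∷-injectiveˡ eq = begin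
    state i₀ r                              ≡⟨ foldl-++ step (source c₀) w r ⟨
    state (source c₀) (w ++ r)              ≡⟨ cong (state (source c₀)) eq ⟩
    state (source c₀) ((c₀ ∷ h) ++ w)       ≡⟨ foldl-++ step (source c₀) (c₀ ∷ h) w ⟩
    state (state (source c₀) (c₀ ∷ h)) w    ≡⟨ cong (λ i → state i w) (state-path c₀ h c₀ hc∈S) ⟩
    i₀                                      ∎
    where
    open ≡.≡-Reasoning
    hc∈S : c₀ ∷ h ∷ʳ c₀ ∈ S
    hc∈S = prefix-∈ (c₀ ∷ h ∷ʳ c₀) (subst (_∈ S)
      (≡.trans eq (cong (c₀ ∷_) (≡.sym (++-assoc h [ c₀ ] w′)))) (IsCompleteReturn.member cr))

  open FreeGroup (subsetSetoid G X) using ()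
    renaming (_∼_ to _∼ᶠ_; group to freeGroup; nil to nilᶠ; cons to consᶠ)

  state-eval : ∀ u → state i₀ (eval G X u) ≡ i₀
  state-eval [] = refl
  state-eval (inj₁ (r , cr) ∷ u) = begin
    state i₀ (r ++ eval G X u)          ≡⟨ foldl-++ step i₀ r (eval G X u) ⟩
    state (state i₀ r) (eval G X u)     ≡⟨ cong (λ i → state i (eval G X u)) (state-return cr) ⟩
    state i₀ (eval G X u)               ≡⟨ state-eval u ⟩
    i₀                                  ∎
    where open ≡.≡-Reasoning
  state-eval (inj₂ (r , cr) ∷ u) = begin
    state i₀ (inverse r ++ eval G X u)                 ≡⟨ cong (λ i → state i (inverse r ++ eval G X u)) (state-return cr) ⟨
    state (state i₀ r) (inverse r ++ eval G X u)       ≡⟨ foldl-++ step i₀ r _ ⟨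
    state i₀ (r ++ inverse r ++ eval G X u)            ≡⟨ state-cong i₀ (\\-leftDividesˡ r (eval G X u)) ⟩
    state i₀ (eval G X u)                              ≡⟨ state-eval u ⟩
    i₀                                                 ∎
    where
    open ≡.≡-Reasoning
    open GroupProperties G using (\\-leftDividesˡ)

  -- Freeness by a left inverse of evaluation.

  module Injectivity (gs : List (Σ W X)) where

    module F = Group freeGroup
    open GroupProperties freeGroup using (∙-cancelˡ; \\-leftDividesˡ)

    private
      realized = realize freeGroup (λ g → [ inj₁ g ]) (λ eq → consᶠ (⊎.inj₁ (∼-reflexive eq)) nilᶠ) gs
      f = proj₁ realized

    open Development freeGroup f public

    -- The word `w ++ r` lies in `S` and develops to the product of the values of `f`; cancelling
    -- `w` leaves the generator that `f` realizes on `r`.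
    develop-return : ∀ {g} → g List.∈ gs → develop i₀ (proj₁ g) ∼ᶠ [ inj₁ g ]
    develop-return {r , cr} g∈ = F.trans (∙-cancelˡ (develop (source c₀) w) _ _ (begin
      develop (source c₀) w F.∙ develop i₀ r      ≈⟨ develop-++ (source c₀) w r ⟨
      develop (source c₀) (w ++ r)                ≈⟨ develop-path c₀ (w′ ++ r) (IsCompleteReturn.member cr) ⟩
      extend freeGroup f (w ++ r)                 ≈⟨ extend-++ freeGroup f w r ⟩
      extend freeGroup f w F.∙ extend freeGroup f r
        ≈⟨ F.∙-congʳ (develop-path c₀ w′ w∈S) ⟨
      develop (source c₀) w F.∙ extend freeGroup f r ∎)) (proj₂ realized g∈)
      where open SetoidReasoning F.setoid

    develop-return-++ : ∀ {g} → g List.∈ gs → ∀ v →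
      develop i₀ (proj₁ g ++ v) ∼ᶠ [ inj₁ g ] F.∙ develop i₀ v
    develop-return-++ {r , cr} g∈ v = F.trans (develop-++ i₀ r v)
      (F.∙-cong (develop-return g∈) (F.reflexive (cong (λ i → develop i v) (state-return cr))))

    develop-eval : ∀ u → (∀ {g} → g List.∈ map reduce u → g List.∈ gs) → develop i₀ (eval G X u) ∼ᶠ u
    develop-eval [] _ = F.refl
    develop-eval (inj₁ g ∷ u) sub = F.trans (develop-return-++ (sub (here refl)) (eval G X u))
      (F.∙-congˡ (develop-eval u (sub ∘ there)))
    -- Return words are developed forwards only, so both sides are first multiplied by the generator
    -- of `r`.
    develop-eval (inj₂ g@(r , _) ∷ u) sub = ∙-cancelˡ [ inj₁ g ] _ _ (begin
      [ inj₁ g ] F.∙ develop i₀ (inverse r ++ eval G X u)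
        ≈⟨ develop-return-++ (sub (here refl)) _ ⟨
      develop i₀ (r ++ inverse r ++ eval G X u)
        ≈⟨ develop-cong i₀ (GroupProperties.\\-leftDividesˡ G r (eval G X u)) ⟩
      develop i₀ (eval G X u)
        ≈⟨ develop-eval u (sub ∘ there) ⟩
      u
        ≈⟨ \\-leftDividesˡ [ inj₁ g ] u ⟨
      [ inj₁ g ] F.∙ (inj₂ g ∷ u) ∎)
      where open SetoidReasoning F.setoid

  eval-injective : ∀ {u v} → eval G X u ∼ eval G X v → u ∼ᶠ v
  eval-injective {u} {v} eq = F.trans (F.sym (develop-eval u ∈-++⁺ˡ))
    (F.trans (develop-cong i₀ eq) (develop-eval v (∈-++⁺ʳ (map reduce u))))
    where
    -- `realize` serves a finite list; the return words occurring in `u` and `v` are enough to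
    -- compare them.
    gs = map reduce u ++ map reduce v
    open Injectivity gs

  isBasis : IsBasisOf G X (EvenSubgroup θ θ-inv spec)
  isBasis = record
    { isMonomorphism = record
      { isGroupHomomorphism = record
        { isMonoidHomomorphism = record
          { isMagmaHomomorphism = record
            { isRelHomomorphism = record { cong = eval-cong }
            ; homo = eval-++
            }
          ; ε-homo = ∼-refl
          }
        ; ⁻¹-homo = eval-inverse
        }
      ; injective = eval-injective
      }
    ; image = λ g → mk⇔
        (λ (v , even , v∼g) →
          let u , eq = even-generated v (even⇒state v i₀ even) in
          u , trans (∼-reflexive (≡.sym (++-identityʳ _))) (trans eq v∼g))
        (λ (u , eq) → eval G X u , state⇒even (eval G X u) i₀ (state-eval u) , eq)
    }

theorem6p15 : ∀ {ℓ : Level} {n : ℕ} (θ : Fin n → Fin n) (θ-inv : Involutive _≡_ θ)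
    (S : Pred (List (Fin n)) ℓ) (spec : IsSpecular θ θ-inv S) → IsRecurrent S →
    ∀ (w : List (Fin n)) → w ≢ [] → w ∈ S →
    IsBasisOf (Gθ θ θ-inv) (RightReturn S w) (EvenSubgroup θ θ-inv spec)
theorem6p15 θ θ-inv S spec rec []       w≢[] _   = ⊥-elim (w≢[] refl)
theorem6p15 θ θ-inv S spec rec (c ∷ w′) _    w∈S = Basis.isBasis θ θ-inv S spec rec c w′ w∈S
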